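{- If $n\equiv 0\pmod 4$, then $\mathcal{G}_n^*$ is connected.
   Context: $\mathcal{G}_n$ is the set of simple 3-regular graphs on vertex set $[n]$. A make move ${\tt make}(yxvwz)$ applies to $G=(V,E)$ when $y,x,v,w,z$ are distinct, $yx,xv,vw,wz\in E$ and $xw,yz\notin E$, and replaces $E$ by $(E\setminus\{xy,wz\})\cup\{xw,yz\}$. A break move ${\tt break}(vxw,yz)$ applies when $vxwv$ is a triangle, $yz\in E$, $\{y,z\}\cap\{v,x,w\}=\emptyset$ and $xy,wz\notin E$, and replaces $E$ by $(E\setminus\{xw,yz\})\cup\{xy,wz\}$. $\mathcal{G}_n^*$ is the graph on vertex set $\mathcal{G}_n$ with $G,G'$ adjacent iff a make or break move takes $G$ to $G'$. -}

module Defs where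

open import Data.Nat using (ℕ; _+_)
open import Data.Bool using (Bool; true; false; _∧_; _∨_; not; if_then_else_)
open import Data.Fin using (Fin; _≟_)
open import Data.List using (List; map; allFin)
open import Data.Nat.ListAction using (sum)
open import Data.Product using (Σ; _×_; _,_)
open import Data.Sum using (_⊎_)
open import Relation.Nullary using (¬_)
open import Relation.Nullary.Decidable using (⌊_⌋)
open import Relation.Binary.PropositionalEquality using (_≡_)
open import Relation.Binary.Construct.Closure.ReflexiveTransitive using (Star)

degree : {n : ℕ} → (Fin n → Fin n → Bool) → Fin n → ℕ
degree {n} A v = sum (map (λ u → if A v u then 1 else 0) (allFin n))

record Cubic (n : ℕ) : Set where
  field
    adj     : Fin n → Fin n → Bool
    irrefl  : ∀ v → adj v v ≡ false
    sym     : ∀ u v → adj u v ≡ adj v u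
    regular : ∀ v → degree adj v ≡ 3
open Cubic public

_∋_~_ : {n : ℕ} → Cubic n → Fin n → Fin n → Set
G ∋ a ~ b = adj G a b ≡ true

samePair : {n : ℕ} → Fin n → Fin n → Fin n → Fin n → Bool
samePair a b x y = (⌊ a ≟ x ⌋ ∧ ⌊ b ≟ y ⌋) ∨ (⌊ a ≟ y ⌋ ∧ ⌊ b ≟ x ⌋)

switch : {n : ℕ} → (Fin n → Fin n → Bool) →
         (p₁ q₁ p₂ q₂ r₁ s₁ r₂ s₂ : Fin n) → Fin n → Fin n → Bool
switch A p₁ q₁ p₂ q₂ r₁ s₁ r₂ s₂ a b =
  (A a b ∧ not (samePair a b p₁ q₁) ∧ not (samePair a b p₂ q₂))
  ∨ samePair a b r₁ s₁ ∨ samePair a b r₂ s₂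

HasAdj : {n : ℕ} → Cubic n → (Fin n → Fin n → Bool) → Set
HasAdj {n} G' A' = ∀ (a b : Fin n) → adj G' a b ≡ A' a b

MakeMove : {n : ℕ} → Cubic n → Cubic n → (y x v w z : Fin n) → Set
MakeMove G G' y x v w z =
  (¬ y ≡ x) × (¬ y ≡ v) × (¬ y ≡ w) × (¬ y ≡ z) × (¬ x ≡ v) ×
  (¬ x ≡ w) × (¬ x ≡ z) × (¬ v ≡ w) × (¬ v ≡ z) × (¬ w ≡ z) ×
  (G ∋ y ~ x) × (G ∋ x ~ v) × (G ∋ v ~ w) × (G ∋ w ~ z) ×
  (¬ G ∋ x ~ w) × (¬ G ∋ y ~ z) ×
  HasAdj G' (switch (adj G) x y w z x w y z)

BreakMove : {n : ℕ} → Cubic n → Cubic n → (v x w y z : Fin n) → Set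
BreakMove G G' v x w y z =
  (G ∋ v ~ x) × (G ∋ x ~ w) × (G ∋ w ~ v) × (G ∋ y ~ z) ×
  (¬ y ≡ v) × (¬ y ≡ x) × (¬ y ≡ w) × (¬ z ≡ v) × (¬ z ≡ x) × (¬ z ≡ w) ×
  (¬ G ∋ x ~ y) × (¬ G ∋ w ~ z) ×
  HasAdj G' (switch (adj G) x w y z x y w z)

Move : {n : ℕ} → Cubic n → Cubic n → Set
Move {n} G G' =
  Σ (Fin n) λ a → Σ (Fin n) λ b → Σ (Fin n) λ c → Σ (Fin n) λ d → Σ (Fin n) λ e →
    MakeMove G G' a b c d e ⊎ BreakMove G G' a b c d e

Adjacent : {n : ℕ} → Cubic n → Cubic n → Set
Adjacent G G' = Move G G' ⊎ Move G' G

SameGraph : {n : ℕ} → Cubic n → Cubic n → Set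
SameGraph G H = HasAdj G (adj H)

Connected* : ℕ → Set
Connected* n = ∀ (G H : Cubic n) →
  Σ (Cubic n) λ H' → Star Adjacent G H' × SameGraph H' H

{-# OPTIONS --safe #-}
module Submission where

-- For n ≥ 8 a copy of K₄ can always be created: any vertex yields a triangle, a triangle a diamond, and a
-- diamond a K₄, each in at most two moves, by a finite case analysis of the surroundings (a component that is
-- a triangular prism borrows an edge from outside).  A K₄ is then a catalyst.  Three moves exchange one of its
-- vertices with any vertex outside, so it can be placed where a second graph has its K₄; and four moves
-- perform an arbitrary switch off the K₄ and restore it.  Hence two graphs with the same K₄ are connected by
-- Taylor's argument for unrestricted switches, equalising the neighbourhoods one vertex at a time.
-- For n = 4 there is a single graph, and n = 6, which has no room for a K₄ component, is excluded by 4 ∣ n.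

open import Defs
open import Data.Bool using (Bool; true; false; _∧_; _∨_; _xor_; not; if_then_else_; T?)
import Data.Bool as Bool
open import Data.Bool.Properties using (T-≡; ∧-comm; ∧-identityʳ; ∧-zeroʳ; ∨-comm; ∨-identityʳ; ∨-zeroʳ; xor-comm)
open import Data.Fin using (Fin; _≟_)
import Data.Fin as Fin
import Data.Fin.Properties as Fin
open import Data.Fin.Permutation.Components using (transpose)
open import Data.List using (List; []; _∷_; _++_; map; length; filterᵇ; upTo; allFin)
open import Data.List.Membership.DecPropositional using () renaming (_∈?_ to member?)
open import Data.List.Membership.Propositional using (_∈_; _∉_; find; lose)
open import Data.List.Membership.Propositional.Properties
  using (∈-∃++; ∈-++⁻; ∈-++⁺ˡ; ∈-++⁺ʳ; ∈-filter⁺; ∈-filter⁻; ∈-allFin; ∈-map⁺; ∈-map⁻; ∈-upTo⁺; ∈-upTo⁻)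
open import Data.List.Properties using (length-++; length-map; length-tabulate; length-upTo)
open import Data.List.Relation.Binary.Subset.Propositional using (_⊆_)
open import Data.List.Relation.Unary.All as All using (All; []; _∷_)
open import Data.List.Relation.Unary.AllPairs using ([]; _∷_)
open import Data.List.Relation.Unary.Any using (here; there; any?)
open import Data.List.Relation.Unary.Unique.DecPropositional using (unique?)
open import Data.List.Relation.Unary.Unique.Propositional using (Unique)
import Data.List.Relation.Unary.Unique.Propositional.Properties as Unique
open import Data.Maybe using (Maybe; just; nothing; _<∣>_)
open import Data.Maybe.Properties using (≡-dec)
open import Data.Nat using (ℕ; zero; suc; _+_; _≤_; _<_; z≤n; s≤s; s≤s⁻¹; _≡ᵇ_; _≤ᵇ_; _<?_)
import Data.Nat as ℕ
open import Data.Nat.DivMod using (_%_)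
open import Data.Nat.ListAction using (sum)
open import Data.Nat.Properties
  using (≤-refl; ≤-reflexive; ≤-trans; ≤-antisym; ≤-<-trans; <-≤-trans; <-trans; <-irrefl; <⇒≢; <⇒≤; <⇒≱; ≤∧≢⇒<;
         ≡ᵇ⇒≡; ≡⇒≡ᵇ; ≤ᵇ⇒≤; +-suc; +-cancelˡ-≡; m≤m+n; module ≤-Reasoning)
open import Data.Product using (Σ; ∃; _×_; _,_; proj₁; proj₂)
open import Data.Sum using (_⊎_; inj₁; inj₂)
open import Data.Unit using (⊤; tt)
open import Function using (_∘_; _$_; id; const; Equivalence)
open import Relation.Binary.Construct.Closure.ReflexiveTransitive using (Star; ε; _◅_; _◅◅_; reverse)
open import Relation.Binary.PropositionalEquality
  using (_≡_; _≢_; refl; trans; cong; cong₂; subst; subst₂) renaming (sym to ≡-sym)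
open import Relation.Nullary using (¬_; Dec; yes; no; contradiction)
open import Relation.Nullary.Decidable using (⌊_⌋; _×-dec_; _⊎-dec_; _→-dec_; ¬?; toWitness; decidable-stable)

-- Both moves are switches, trading two edges for two others on the same four vertices. But `make`
-- also wants a common neighbour of one end of each edge, and `break` a triangle on one of the
-- edges. A general switch comes with neither; the K₄ has triangles to lend, and gets them back at
-- the end. The case analyses are run by evaluation. A `Picture` records what is known about a few
-- named vertices, and 3-regularity supplies most of the non-adjacencies. A strategy is a `Plan`;
-- its validity on pictures is decidable, and its soundness is proved once for all graphs. In
-- Taylor's argument the K₄ lies among the vertices already settled. All switches used avoid those,
-- so the K₄ stays intact and available. Either graph may be the one that moves, since paths can be
-- reversed.

unique-⊆⇒length-≤ : {A : Set} {xs ys : List A} → Unique xs → xs ⊆ ys → length xs ≤ length ys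
unique-⊆⇒length-≤ {xs = []} _ _ = z≤n
unique-⊆⇒length-≤ {xs = x ∷ xs} (x≢xs ∷ uniq) xs⊆ys with ∈-∃++ (xs⊆ys (here refl))
... | as , bs , refl = begin
  suc (length xs)                ≤⟨ s≤s (unique-⊆⇒length-≤ uniq xs⊆as++bs) ⟩
  suc (length (as ++ bs))        ≡⟨ cong suc (length-++ as) ⟩
  suc (length as + length bs)    ≡⟨ +-suc (length as) (length bs) ⟨
  length as + length (x ∷ bs)    ≡⟨ length-++ as ⟨
  length (as ++ x ∷ bs)          ∎
  where
  open ≤-Reasoning
  xs⊆as++bs : xs ⊆ as ++ bs
  xs⊆as++bs z∈xs with ∈-++⁻ as (xs⊆ys (there z∈xs))
  ... | inj₁ z∈as         = ∈-++⁺ˡ z∈as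
  ... | inj₂ (here z≡x)   = contradiction (≡-sym z≡x) (All.lookup x≢xs z∈xs)
  ... | inj₂ (there z∈bs) = ∈-++⁺ʳ as z∈bs

unique-map : {A B : Set} {f : A → B} {xs : List A} →
             (∀ {x y} → x ∈ xs → y ∈ xs → f x ≡ f y → x ≡ y) → Unique xs → Unique (map f xs)
unique-map {xs = []} _ _ = []
unique-map {f = f} {xs = x ∷ xs} inj (x≢xs ∷ uniq) =
  All.tabulate fx≢ ∷ unique-map (λ p q → inj (there p) (there q)) uniq
  where
  fx≢ : ∀ {b} → b ∈ map f xs → f x ≢ b
  fx≢ b∈ fx≡b with ∈-map⁻ f b∈
  ... | y , y∈xs , refl = All.lookup x≢xs y∈xs (inj (here refl) (there y∈xs) fx≡b)

⌊≟⌋-refl : ∀ {n} (a : Fin n) → ⌊ a ≟ a ⌋ ≡ true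
⌊≟⌋-refl a with a ≟ a
... | yes _  = refl
... | no a≢a = contradiction refl a≢a

⌊≟⌋-≢ : ∀ {n} {a b : Fin n} → a ≢ b → ⌊ a ≟ b ⌋ ≡ false
⌊≟⌋-≢ {a = a} {b} a≢b with a ≟ b
... | yes a≡b = contradiction a≡b a≢b
... | no _    = refl

¬true⇒false : ∀ {b} → ¬ b ≡ true → b ≡ false
¬true⇒false {false} _ = refl
¬true⇒false {true}  b≢true = contradiction refl b≢true

false⇒¬true : ∀ {b} → b ≡ false → ¬ b ≡ true
false⇒¬true refl ()

private variable
  n : ℕ
  p q : Fin n → Bool

members : (Fin n → Bool) → List (Fin n)
members {n} p = filterᵇ p (allFin n)

count : (Fin n → Bool) → ℕ
count p = length (members p)

members⁺ : ∀ {u} → p u ≡ true → u ∈ members p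
members⁺ {p = p} {u} pu = ∈-filter⁺ (T? ∘ p) (∈-allFin u) (Equivalence.from T-≡ pu)

members⁻ : ∀ {u} → u ∈ members p → p u ≡ true
members⁻ {n} {p = p} u∈ = Equivalence.to T-≡ (proj₂ (∈-filter⁻ (T? ∘ p) {xs = allFin n} u∈))

members-unique : (p : Fin n → Bool) → Unique (members p)
members-unique {n} p = Unique.filter⁺ (T? ∘ p) (Unique.allFin⁺ n)

∃-outside : (xs : List (Fin n)) → length xs < count p → ∃ λ u → p u ≡ true × u ∉ xs
∃-outside {n} {p = p} xs short with any? (λ u → ¬? (any? (u ≟_) xs)) (members p)
... | yes found = let u , u∈ , u∉xs = find found in u , members⁻ u∈ , u∉xs
... | no none = contradiction (unique-⊆⇒length-≤ (members-unique p) ⊆xs) (<⇒≱ short)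
  where
  ⊆xs : members p ⊆ xs
  ⊆xs {u} u∈ = decidable-stable (any? (u ≟_) xs) (λ u∉xs → none (lose u∈ u∉xs))

unique-members⇒length-≤ : {xs : List (Fin n)} → Unique xs → (∀ {u} → u ∈ xs → p u ≡ true) → length xs ≤ count p
unique-members⇒length-≤ {p = p} uniq sub = unique-⊆⇒length-≤ {ys = members p} uniq (λ u∈ → members⁺ (sub u∈))

count-≤ : (π : Fin n → Fin n) → (∀ {x y} → π x ≡ π y → x ≡ y) →
          (∀ u → p u ≡ true → q (π u) ≡ true) → count p ≤ count q
count-≤ {p = p} {q} π inj sub = subst (_≤ count q) (length-map π (members p))
  (unique-members⇒length-≤ (Unique.map⁺ inj (members-unique p)) mapped)
  where
  mapped : ∀ {u} → u ∈ map π (members p) → q u ≡ true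
  mapped u∈ with ∈-map⁻ π u∈
  ... | v , v∈ , refl = sub v (members⁻ v∈)

count-< : (π : Fin n → Fin n) → (∀ {x y} → π x ≡ π y → x ≡ y) →
          (∀ u → p u ≡ true → q (π u) ≡ true) →
          ∀ v → q v ≡ true → (∀ u → p u ≡ true → π u ≢ v) → count p < count q
count-< {p = p} {q} π inj sub v qv fresh = subst (λ l → suc l ≤ count q) (length-map π (members p))
  (unique-members⇒length-≤ (All.tabulate v≢ ∷ Unique.map⁺ inj (members-unique p)) mapped)
  where
  v≢ : ∀ {u} → u ∈ map π (members p) → v ≢ u
  v≢ u∈ v≡u with ∈-map⁻ π u∈
  ... | w , w∈ , refl = fresh w (members⁻ w∈) (≡-sym v≡u)
  mapped : ∀ {u} → u ∈ v ∷ map π (members p) → q u ≡ true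
  mapped (here refl) = qv
  mapped (there u∈) with ∈-map⁻ π u∈
  ... | w , w∈ , refl = sub w (members⁻ w∈)

count-cong : (∀ u → p u ≡ q u) → count p ≡ count q
count-cong p≗q = ≤-antisym (count-≤ id id (λ u → trans (≡-sym (p≗q u)))) (count-≤ id id (λ u → trans (p≗q u)))

count-split : (s p : Fin n → Bool) → count (λ u → s u ∧ p u) + count (λ u → not (s u) ∧ p u) ≡ count p
count-split {n} s p = go (allFin n)
  where
  go : ∀ us → length (filterᵇ (λ u → s u ∧ p u) us) + length (filterᵇ (λ u → not (s u) ∧ p u) us)
              ≡ length (filterᵇ p us)
  go [] = refl
  go (u ∷ us) with s u | p u
  ... | true  | true  = cong suc (go us)
  ... | true  | false = go us
  ... | false | true  = trans (+-suc _ _) (cong suc (go us))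
  ... | false | false = go us

degree≡count : (A : Fin n → Fin n → Bool) (v : Fin n) → degree A v ≡ count (A v)
degree≡count {n} A v = go (allFin n)
  where
  go : ∀ us → sum (map (λ u → if A v u then 1 else 0) us) ≡ length (filterᵇ (A v) us)
  go [] = refl
  go (u ∷ us) with A v u
  ... | true  = cong suc (go us)
  ... | false = go us

count-adj : (G : Cubic n) (v : Fin n) → count (adj G v) ≡ 3
count-adj G v = trans (≡-sym (degree≡count (adj G) v)) (regular G v)

-- Unordered pairs and transpositions

samePair-sym : (a b x y : Fin n) → samePair a b x y ≡ samePair b a x y
samePair-sym a b x y =
  trans (∨-comm (⌊ a ≟ x ⌋ ∧ ⌊ b ≟ y ⌋) _)
        (cong₂ _∨_ (∧-comm ⌊ a ≟ y ⌋ _) (∧-comm ⌊ a ≟ x ⌋ _))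

samePair-diag : ∀ (v : Fin n) {x y} → x ≢ y → samePair v v x y ≡ false
samePair-diag v {x} {y} x≢y with v ≟ x | v ≟ y
... | yes refl | yes refl = contradiction refl x≢y
... | yes _    | no _     = refl
... | no _     | yes _    = refl
... | no _     | no _     = refl

transpose-left : (a b : Fin n) → transpose a b a ≡ b
transpose-left a b with a ≟ a
... | yes _  = refl
... | no a≢a = contradiction refl a≢a

transpose-right : (a b : Fin n) → transpose a b b ≡ a
transpose-right a b with b ≟ a
... | yes b≡a = b≡a
... | no _ with b ≟ b
...   | yes _  = refl
...   | no b≢b = contradiction refl b≢b

transpose-other : (a b : Fin n) {u : Fin n} → u ≢ a → u ≢ b → transpose a b u ≡ u
transpose-other a b {u} u≢a u≢b with u ≟ a
... | yes u≡a = contradiction u≡a u≢a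
... | no _ with u ≟ b
...   | yes u≡b = contradiction u≡b u≢b
...   | no _    = refl

transpose-self : (a u : Fin n) → transpose a a u ≡ u
transpose-self a u with a ≟ u
... | yes refl = transpose-left a a
... | no a≢u   = transpose-other a a (a≢u ∘ ≡-sym) (a≢u ∘ ≡-sym)

transpose-involutive : (a b u : Fin n) → transpose a b (transpose a b u) ≡ u
transpose-involutive a b u = by-cases (u ≟ a) (u ≟ b)
  where
  by-cases : Dec (u ≡ a) → Dec (u ≡ b) → transpose a b (transpose a b u) ≡ u
  by-cases (yes refl) _ = trans (cong (transpose a b) (transpose-left a b)) (transpose-right a b)
  by-cases (no _) (yes refl) = trans (cong (transpose a b) (transpose-right a b)) (transpose-left a b)
  by-cases (no u≢a) (no u≢b) =
    trans (cong (transpose a b) (transpose-other a b u≢a u≢b)) (transpose-other a b u≢a u≢b)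

transpose-injective : (a b : Fin n) {u v : Fin n} → transpose a b u ≡ transpose a b v → u ≡ v
transpose-injective a b {u} {v} e =
  trans (≡-sym (transpose-involutive a b u)) (trans (cong (transpose a b) e) (transpose-involutive a b v))

-- Unrestricted switches

record Switchable (G : Cubic n) (x y w z : Fin n) : Set where
  field
    x≢w : x ≢ w
    x≢z : x ≢ z
    y≢w : y ≢ w
    y≢z : y ≢ z
    x~y : adj G x y ≡ true
    w~z : adj G w z ≡ true
    x≁w : adj G x w ≡ false
    y≁z : adj G y z ≡ false

~⇒≢ : (G : Cubic n) → ∀ {u v} → adj G u v ≡ true → u ≢ v
~⇒≢ G {u} u~u refl = false⇒¬true (irrefl G u) u~u

≁-sym : (G : Cubic n) → ∀ {u v} → adj G u v ≡ false → adj G v u ≡ false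
≁-sym G {u} {v} = trans (Defs.sym G v u)

~-sym : (G : Cubic n) → ∀ {u v} → adj G u v ≡ true → adj G v u ≡ true
~-sym G {u} {v} = trans (Defs.sym G v u)

-- Trades xy, wz for xw, yz. Both kinds of move have this form, `break` after renaming.
switched : (Fin n → Fin n → Bool) → (x y w z : Fin n) → Fin n → Fin n → Bool
switched A x y w z = switch A x y w z x w y z

module _ (G : Cubic n) {x y w z : Fin n} (S : Switchable G x y w z) where
  open Switchable S

  private
    A′ : Fin n → Fin n → Bool
    A′ = switched (adj G) x y w z

    x≢y : x ≢ y
    x≢y = ~⇒≢ G x~y

    w≢z : w ≢ z
    w≢z = ~⇒≢ G w~z

    exchange : ∀ v {a b} → adj G v a ≡ true → adj G v b ≡ false → ∀ u →
               (adj G v u ∧ not ⌊ u ≟ a ⌋) ∨ ⌊ u ≟ b ⌋ ≡ adj G v (transpose a b u)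
    exchange v {a} {b} v~a v≁b u with u ≟ a
    ... | yes refl with u ≟ b
    ...   | yes refl = contradiction v~a (false⇒¬true v≁b)
    ...   | no _ rewrite v~a = ≡-sym v≁b
    exchange v {a} {b} v~a v≁b u | no _ with u ≟ b
    ...   | yes refl rewrite v≁b = ≡-sym v~a
    ...   | no _ = trans (∨-identityʳ _) (∧-identityʳ _)

  -- Each of the four vertices loses one neighbour and gains another, so its new row is the old one
  -- read through the transposition of the two. This is why degrees are preserved.
  switched-row-x : ∀ u → A′ x u ≡ adj G x (transpose y w u)
  switched-row-x u
    rewrite ⌊≟⌋-refl x | ⌊≟⌋-≢ x≢y | ⌊≟⌋-≢ x≢w | ⌊≟⌋-≢ x≢z
          | ∨-identityʳ ⌊ u ≟ y ⌋ | ∨-identityʳ ⌊ u ≟ w ⌋ | ∨-identityʳ ⌊ u ≟ w ⌋ | ∧-identityʳ (not ⌊ u ≟ y ⌋)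
    = exchange x x~y x≁w u

  switched-row-y : ∀ u → A′ y u ≡ adj G y (transpose x z u)
  switched-row-y u
    rewrite ⌊≟⌋-refl y | ⌊≟⌋-≢ (x≢y ∘ ≡-sym) | ⌊≟⌋-≢ y≢w | ⌊≟⌋-≢ y≢z
          | ∨-identityʳ ⌊ u ≟ z ⌋ | ∧-identityʳ (not ⌊ u ≟ x ⌋)
    = exchange y (~-sym G x~y) y≁z u

  switched-row-w : ∀ u → A′ w u ≡ adj G w (transpose z x u)
  switched-row-w u
    rewrite ⌊≟⌋-refl w | ⌊≟⌋-≢ (x≢w ∘ ≡-sym) | ⌊≟⌋-≢ (y≢w ∘ ≡-sym) | ⌊≟⌋-≢ w≢z
          | ∨-identityʳ ⌊ u ≟ z ⌋ | ∨-identityʳ ⌊ u ≟ x ⌋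
    = exchange w w~z (≁-sym G x≁w) u

  switched-row-z : ∀ u → A′ z u ≡ adj G z (transpose w y u)
  switched-row-z u
    rewrite ⌊≟⌋-refl z | ⌊≟⌋-≢ (x≢z ∘ ≡-sym) | ⌊≟⌋-≢ (y≢z ∘ ≡-sym) | ⌊≟⌋-≢ (w≢z ∘ ≡-sym)
    = exchange z (~-sym G w~z) (≁-sym G y≁z) u

  switched-row-other : ∀ {v} → v ≢ x → v ≢ y → v ≢ w → v ≢ z → ∀ u → A′ v u ≡ adj G v u
  switched-row-other v≢x v≢y v≢w v≢z u
    rewrite ⌊≟⌋-≢ v≢x | ⌊≟⌋-≢ v≢y | ⌊≟⌋-≢ v≢w | ⌊≟⌋-≢ v≢z
    = trans (∨-identityʳ _) (∧-identityʳ _)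

  private
    row-transposed : ∀ v → ∃ λ a → ∃ λ b → ∀ u → A′ v u ≡ adj G v (transpose a b u)
    row-transposed v = by-cases (v ≟ x) (v ≟ y) (v ≟ w) (v ≟ z)
      where
      by-cases : Dec (v ≡ x) → Dec (v ≡ y) → Dec (v ≡ w) → Dec (v ≡ z) →
                 ∃ λ a → ∃ λ b → ∀ u → A′ v u ≡ adj G v (transpose a b u)
      by-cases (yes refl) _ _ _ = y , w , switched-row-x
      by-cases _ (yes refl) _ _ = x , z , switched-row-y
      by-cases _ _ (yes refl) _ = z , x , switched-row-w
      by-cases _ _ _ (yes refl) = w , y , switched-row-z
      -- An untouched row fits the same form through the trivial transposition.
      by-cases (no v≢x) (no v≢y) (no v≢w) (no v≢z) = v , v , λ u →
        trans (switched-row-other v≢x v≢y v≢w v≢z u) (cong (adj G v) (≡-sym (transpose-self v u)))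

    switched-regular : ∀ v → degree A′ v ≡ 3
    switched-regular v with row-transposed v
    ... | a , b , row = trans (degree≡count A′ v) (trans (≤-antisym ≤₁ ≤₂) (count-adj G v))
      where
      ≤₁ : count (A′ v) ≤ count (adj G v)
      ≤₁ = count-≤ (transpose a b) (transpose-injective a b) (λ u e → trans (≡-sym (row u)) e)
      ≤₂ : count (adj G v) ≤ count (A′ v)
      ≤₂ = count-≤ (transpose a b) (transpose-injective a b)
             (λ u e → trans (row _) (trans (cong (adj G v) (transpose-involutive a b u)) e))

  sw : Cubic n
  sw .adj = A′
  sw .irrefl v
    rewrite irrefl G v | samePair-diag v x≢w | samePair-diag v y≢z = refl
  sw .Cubic.sym u v
    rewrite Defs.sym G u v | samePair-sym u v x y | samePair-sym u v w z
          | samePair-sym u v x w | samePair-sym u v y z = refl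
  sw .regular = switched-regular

-- Moves and reachability up to equality of adjacency

Move-respˡ : {G G′ H : Cubic n} → SameGraph G G′ → Move G H → Move G′ H
Move-respˡ {G = G} {G′} {H} G≈G′ = λ where
    (a , b , c , d , e , inj₁ (n₁ , n₂ , n₃ , n₄ , n₅ , n₆ , n₇ , n₈ , n₉ , n₀ , e₁ , e₂ , e₃ , e₄ , f₁ , f₂ , h)) →
      a , b , c , d , e , inj₁ (n₁ , n₂ , n₃ , n₄ , n₅ , n₆ , n₇ , n₈ , n₉ , n₀ ,
                                t e₁ , t e₂ , t e₃ , t e₄ , f₁ ∘ t⁻ , f₂ ∘ t⁻ , has-adj h)
    (a , b , c , d , e , inj₂ (e₁ , e₂ , e₃ , e₄ , n₁ , n₂ , n₃ , n₄ , n₅ , n₆ , f₁ , f₂ , h)) →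
      a , b , c , d , e , inj₂ (t e₁ , t e₂ , t e₃ , t e₄ , n₁ , n₂ , n₃ , n₄ , n₅ , n₆ , f₁ ∘ t⁻ , f₂ ∘ t⁻ , has-adj h)
  where
  t : ∀ {u v} → G ∋ u ~ v → G′ ∋ u ~ v
  t = trans (≡-sym (G≈G′ _ _))
  t⁻ : ∀ {u v} → G′ ∋ u ~ v → G ∋ u ~ v
  t⁻ = trans (G≈G′ _ _)
  has-adj : ∀ {x y w z r s p q} → HasAdj H (switch (adj G) x y w z r s p q) →
            HasAdj H (switch (adj G′) x y w z r s p q)
  has-adj h u v = trans (h u v) (cong (λ α → (α ∧ _) ∨ _) (G≈G′ u v))

Move-respʳ : {G H H′ : Cubic n} → SameGraph H H′ → Move G H → Move G H′
Move-respʳ H≈H′ = λ where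
    (a , b , c , d , e , inj₁ (n₁ , n₂ , n₃ , n₄ , n₅ , n₆ , n₇ , n₈ , n₉ , n₀ , e₁ , e₂ , e₃ , e₄ , f₁ , f₂ , h)) →
      a , b , c , d , e , inj₁ (n₁ , n₂ , n₃ , n₄ , n₅ , n₆ , n₇ , n₈ , n₉ , n₀ , e₁ , e₂ , e₃ , e₄ , f₁ , f₂ ,
                                λ u v → trans (≡-sym (H≈H′ u v)) (h u v))
    (a , b , c , d , e , inj₂ (e₁ , e₂ , e₃ , e₄ , n₁ , n₂ , n₃ , n₄ , n₅ , n₆ , f₁ , f₂ , h)) →
      a , b , c , d , e , inj₂ (e₁ , e₂ , e₃ , e₄ , n₁ , n₂ , n₃ , n₄ , n₅ , n₆ , f₁ , f₂ ,
                                λ u v → trans (≡-sym (H≈H′ u v)) (h u v))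

Adjacent-respˡ : {G G′ H : Cubic n} → SameGraph G G′ → Adjacent G H → Adjacent G′ H
Adjacent-respˡ {G = G} {G′} {H} G≈G′ (inj₁ m) = inj₁ (Move-respˡ {G = G} {G′} {H} G≈G′ m)
Adjacent-respˡ {G = G} {G′} {H} G≈G′ (inj₂ m) = inj₂ (Move-respʳ {G = H} {G} {G′} G≈G′ m)

Adjacent-sym : {G H : Cubic n} → Adjacent G H → Adjacent H G
Adjacent-sym (inj₁ m) = inj₂ m
Adjacent-sym (inj₂ m) = inj₁ m

infix 4 _⇝_
-- A `Cubic` contains functions and proofs, so two records of one graph need not be propositionally
-- equal; a path is only asked to end at a record with the adjacency of `H`.
record _⇝_ (G H : Cubic n) : Set where
  constructor reach
  field
    {end}   : Cubic n
    path    : Star Adjacent G end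
    arrives : SameGraph end H

⇝-reflexive : {G H : Cubic n} → SameGraph G H → G ⇝ H
⇝-reflexive {G = G} G≈H = reach {end = G} ε G≈H

⇝-refl : {G : Cubic n} → G ⇝ G
⇝-refl = ⇝-reflexive λ _ _ → refl

Adjacent⇒⇝ : {G H : Cubic n} → Adjacent G H → G ⇝ H
Adjacent⇒⇝ {H = H} s = reach {end = H} (s ◅ ε) λ _ _ → refl

⇝-trans : {G H K : Cubic n} → G ⇝ H → H ⇝ K → G ⇝ K
⇝-trans (reach ss H′≈H) (reach {end = K′} ε K′≈K) = reach ss λ a b → trans (H′≈H a b) (K′≈K a b)
-- Only the first move of the second path departs from `H`; once it is transported to `H′`, the rest
-- of that path can stay.
⇝-trans {H = H} (reach {end = H′} ss H′≈H) (reach (_◅_ {j = L} t ts) K′≈K) =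
  reach (ss ◅◅ (Adjacent-respˡ {G = H} {H′} {L} (λ a b → ≡-sym (H′≈H a b)) t ◅ ts)) K′≈K

⇝-sym : {G H : Cubic n} → G ⇝ H → H ⇝ G
⇝-sym {G = G} (reach ss H′≈H) =
  ⇝-trans (⇝-reflexive λ a b → ≡-sym (H′≈H a b))
          (reach {end = G} (reverse (λ {K} {L} → Adjacent-sym {G = K} {L}) ss) λ _ _ → refl)

-- Partial pictures of a graph

-- Partial knowledge of the adjacencies among distinct vertices f 0, …, f (k − 1), with nothing for "unknown".
-- Entries outside this range are junk.
Picture : Set
Picture = ℕ → ℕ → Maybe Bool

record Realises (G : Cubic n) (f : ℕ → Fin n) (k : ℕ) (P : Picture) : Set where
  field
    injective : ∀ {i j} → i < k → j < k → f i ≡ f j → i ≡ j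
    sound     : ∀ {i j b} → i < k → j < k → P i j ≡ just b → adj G (f i) (f j) ≡ b
open Realises

≡ᵇ-true⁻ : ∀ {i j} → (i ≡ᵇ j) ≡ true → i ≡ j
≡ᵇ-true⁻ {i} {j} e = ≡ᵇ⇒≡ i j (Equivalence.from T-≡ e)

≡ᵇ-false⁻ : ∀ {i j} → (i ≡ᵇ j) ≡ false → i ≢ j
≡ᵇ-false⁻ {i} e refl = false⇒¬true e (Equivalence.to T-≡ (≡⇒≡ᵇ i i refl))

same : ℕ → ℕ → ℕ → ℕ → Bool
same a b i j = ((a ≡ᵇ i) ∧ (b ≡ᵇ j)) ∨ ((a ≡ᵇ j) ∧ (b ≡ᵇ i))

_[_,_≔_] : Picture → ℕ → ℕ → Bool → Picture
(P [ i , j ≔ c ]) a b = if same a b i j then just c else P a b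

certain : Maybe Bool → Bool
certain (just b) = b
certain nothing  = false

certain⁻ : ∀ {m} → certain m ≡ true → m ≡ just true
certain⁻ {just true} _ = refl

seen : Picture → ℕ → ℕ → List ℕ
seen P k i = filterᵇ (λ j → certain (P i j)) (upTo k)

saturated : Picture → ℕ → ℕ → Bool
saturated P k i = 3 ≤ᵇ length (seen P k i)

-- Besides what is recorded, a vertex with three recorded neighbours has no others.
known : Picture → ℕ → Picture
known P k i j =
  if i ≡ᵇ j then just false
  else P i j <∣> P j i <∣> (if saturated P k i ∨ saturated P k j then just false else nothing)

seen⁻ : ∀ P k i {j} → j ∈ seen P k i → j < k × P i j ≡ just true
seen⁻ P k i j∈ with ∈-filter⁻ (λ j → T? (certain (P i j))) {xs = upTo k} j∈
... | j∈upTo , c = ∈-upTo⁻ j∈upTo , certain⁻ (Equivalence.to T-≡ c)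

seen⁺ : ∀ P {k i j} → j < k → P i j ≡ just true → j ∈ seen P k i
seen⁺ P {i = i} j<k Pij = ∈-filter⁺ (λ j → T? (certain (P i j))) (∈-upTo⁺ j<k) (Equivalence.from T-≡ (cong certain Pij))

module _ {G : Cubic n} {f : ℕ → Fin n} {k : ℕ} {P : Picture} (R : Realises G f k P) where

  seen-unique : ∀ i → Unique (map f (seen P k i))
  seen-unique i = unique-map (λ p q → injective R (proj₁ (seen⁻ P k i p)) (proj₁ (seen⁻ P k i q)))
                             (Unique.filter⁺ (λ j → T? (certain (P i j))) (Unique.upTo⁺ k))

  -- Otherwise `f j` and the images of the recorded neighbours would be four neighbours of `f i`.
  saturated⇒≁ : ∀ {i j} → i < k → j < k → saturated P k i ≡ true → P i j ≡ nothing → adj G (f i) (f j) ≡ false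
  saturated⇒≁ {i} {j} i<k j<k sat Pij = ¬true⇒false λ fi~fj → <-irrefl refl (≤-trans (s≤s three) (four fi~fj))
    where
    three : 3 ≤ length (map f (seen P k i))
    three = ≤-trans (≤ᵇ⇒≤ 3 _ (Equivalence.from T-≡ sat)) (≤-reflexive (≡-sym (length-map f (seen P k i))))
    fj∉ : ∀ {u} → u ∈ map f (seen P k i) → f j ≢ u
    fj∉ u∈ fj≡u with ∈-map⁻ f u∈
    ... | l , l∈ , refl with injective R j<k (proj₁ (seen⁻ P k i l∈)) fj≡u
    ... | refl with trans (≡-sym Pij) (proj₂ (seen⁻ P k i l∈))
    ... | ()
    neighbour : adj G (f i) (f j) ≡ true → ∀ {u} → u ∈ f j ∷ map f (seen P k i) → adj G (f i) u ≡ true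
    neighbour fi~fj (here refl) = fi~fj
    neighbour fi~fj (there u∈) with ∈-map⁻ f u∈
    ... | l , l∈ , refl = sound R i<k (proj₁ (seen⁻ P k i l∈)) (proj₂ (seen⁻ P k i l∈))
    four : adj G (f i) (f j) ≡ true → suc (length (map f (seen P k i))) ≤ 3
    four fi~fj = subst (suc (length (map f (seen P k i))) ≤_) (count-adj G (f i))
      (unique-members⇒length-≤ (All.tabulate fj∉ ∷ seen-unique i) (neighbour fi~fj))

  known-sound : ∀ {i j b} → i < k → j < k → known P k i j ≡ just b → adj G (f i) (f j) ≡ b
  known-sound {i} {j} i<k j<k e
    with i ≡ᵇ j in i≡ᵇj | P i j in Pij | P j i in Pji | saturated P k i in sᵢ | saturated P k j in sⱼ
  known-sound {i} {j} i<k j<k refl | true | _ | _ | _ | _ with ≡ᵇ-true⁻ {i} {j} i≡ᵇj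
  ... | refl = irrefl G (f i)
  known-sound i<k j<k refl | false | just _  | _       | _     | _    = sound R i<k j<k Pij
  known-sound i<k j<k refl | false | nothing | just _  | _     | _    = trans (Defs.sym G _ _) (sound R j<k i<k Pji)
  known-sound i<k j<k refl | false | nothing | nothing | true  | _    = saturated⇒≁ i<k j<k sᵢ Pij
  known-sound i<k j<k refl | false | nothing | nothing | false | true = trans (Defs.sym G _ _) (saturated⇒≁ j<k i<k sⱼ Pji)

  ⌊≟⌋-image : ∀ {i j} → i < k → j < k → ⌊ f i Fin.≟ f j ⌋ ≡ (i ≡ᵇ j)
  ⌊≟⌋-image {i} {j} i<k j<k with i ≡ᵇ j in e
  ... | true with ≡ᵇ-true⁻ {i} {j} e
  ...   | refl = ⌊≟⌋-refl (f i)
  ⌊≟⌋-image {i} {j} i<k j<k | false = ⌊≟⌋-≢ (≡ᵇ-false⁻ {i} {j} e ∘ injective R i<k j<k)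

  samePair-image : ∀ {a b i j} → a < k → b < k → i < k → j < k → samePair (f a) (f b) (f i) (f j) ≡ same a b i j
  samePair-image a<k b<k i<k j<k =
    cong₂ _∨_ (cong₂ _∧_ (⌊≟⌋-image a<k i<k) (⌊≟⌋-image b<k j<k)) (cong₂ _∧_ (⌊≟⌋-image a<k j<k) (⌊≟⌋-image b<k i<k))

  same-image : ∀ {a b i j} → i < k → j < k → same a b i j ≡ true → adj G (f a) (f b) ≡ adj G (f i) (f j)
  same-image {a} {b} {i} {j} i<k j<k e with a ≡ᵇ i in ai | b ≡ᵇ j in bj | a ≡ᵇ j in aj | b ≡ᵇ i in bi
  ... | true  | true  | _    | _    rewrite ≡ᵇ-true⁻ {a} ai | ≡ᵇ-true⁻ {b} bj = refl
  ... | true  | false | true | true rewrite ≡ᵇ-true⁻ {a} aj | ≡ᵇ-true⁻ {b} bi = Defs.sym G _ _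
  ... | false | _     | true | true rewrite ≡ᵇ-true⁻ {a} aj | ≡ᵇ-true⁻ {b} bi = Defs.sym G _ _

  assign : ∀ {i j c} → i < k → j < k → adj G (f i) (f j) ≡ c → Realises G f k (P [ i , j ≔ c ])
  assign _ _ _ .injective = injective R
  assign {i} {j} i<k j<k fifj .sound {a} {b} a<k b<k e with same a b i j in s
  assign {i} {j} i<k j<k fifj .sound {a} {b} a<k b<k refl | true  = trans (same-image {a} {b} {i} {j} i<k j<k s) fifj
  assign {i} {j} i<k j<k fifj .sound a<k b<k e    | false = sound R a<k b<k e

-- Nothing changes on pairs that leave the picture. With this, a picture in which every pair is
-- decided determines the whole graph after a sequence of moves.
Frame : (G G′ : Cubic n) (f : ℕ → Fin n) (k : ℕ) → Set
Frame G G′ f k = ∀ a b → (∀ {i} → i < k → a ≢ f i) ⊎ (∀ {i} → i < k → b ≢ f i) → adj G′ a b ≡ adj G a b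

swap : Picture → (x y w z : ℕ) → Picture
swap P x y w z = P [ x , y ≔ false ] [ w , z ≔ false ] [ x , w ≔ true ] [ y , z ≔ true ]

sw-realises : {G : Cubic n} {f : ℕ → Fin n} {k : ℕ} {P : Picture} → Realises G f k P →
  ∀ {x y w z} → x < k → y < k → w < k → z < k → (S : Switchable G (f x) (f y) (f w) (f z)) →
  Realises (sw G S) f k (swap P x y w z)
sw-realises R _ _ _ _ _ .injective = injective R
sw-realises {G = G} {f} {P = P} R {x} {y} {w} {z} x<k y<k w<k z<k S .sound {i} {j} i<k j<k e
  rewrite samePair-image R i<k j<k x<k y<k | samePair-image R i<k j<k w<k z<k
        | samePair-image R i<k j<k x<k w<k | samePair-image R i<k j<k y<k z<k
  with same i j x y | same i j w z | same i j x w | same i j y z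
sw-realises R x<k y<k w<k z<k S .sound i<k j<k refl | s₁ | s₂ | s₃ | true
  rewrite ∨-zeroʳ s₃ = ∨-zeroʳ _
sw-realises R x<k y<k w<k z<k S .sound i<k j<k refl | s₁ | s₂ | true | false = ∨-zeroʳ _
sw-realises R x<k y<k w<k z<k S .sound i<k j<k refl | s₁ | true | false | false
  rewrite ∧-zeroʳ (not s₁) = trans (∨-identityʳ _) (∧-zeroʳ _)
sw-realises R x<k y<k w<k z<k S .sound i<k j<k refl | true | false | false | false = trans (∨-identityʳ _) (∧-zeroʳ _)
sw-realises R x<k y<k w<k z<k S .sound i<k j<k e | false | false | false | false =
  trans (∨-identityʳ _) (trans (∧-identityʳ _) (sound R i<k j<k e))

sw-frame : (G : Cubic n) (f : ℕ → Fin n) {k : ℕ} →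
  ∀ {x y w z} → x < k → y < k → w < k → z < k → (S : Switchable G (f x) (f y) (f w) (f z)) → Frame G (sw G S) f k
sw-frame G f x<k y<k w<k z<k S a b (inj₁ a∉) = switched-row-other G S (a∉ x<k) (a∉ y<k) (a∉ w<k) (a∉ z<k) b
sw-frame G f x<k y<k w<k z<k S a b (inj₂ b∉) =
  trans (Defs.sym (sw G S) a b)
    (trans (switched-row-other G S (b∉ x<k) (b∉ y<k) (b∉ w<k) (b∉ z<k) a) (Defs.sym G b a))

-- Moves carried out on pictures

data Step : Set where
  make  : (y x v w z : ℕ) → Step
  break : (v x w y z : ℕ) → Step

vertices : Step → List ℕ
vertices (make y x v w z)  = y ∷ x ∷ v ∷ w ∷ z ∷ []
vertices (break v x w y z) = v ∷ x ∷ w ∷ y ∷ z ∷ []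

edges : Step → List (ℕ × ℕ)
edges (make y x v w z)  = (y , x) ∷ (x , v) ∷ (v , w) ∷ (w , z) ∷ []
edges (break v x w y z) = (v , x) ∷ (x , w) ∷ (w , v) ∷ (y , z) ∷ []

nonedges : Step → List (ℕ × ℕ)
nonedges (make y x v w z)  = (x , w) ∷ (y , z) ∷ []
nonedges (break v x w y z) = (x , y) ∷ (w , z) ∷ []

after : Step → Picture → Picture
after (make y x v w z)  P = swap P x y w z
after (break v x w y z) P = swap P x w y z

_≟ᵐ_ : (a b : Maybe Bool) → Dec (a ≡ b)
_≟ᵐ_ = ≡-dec Bool._≟_

record Legal (k : ℕ) (P : Picture) (s : Step) : Set where
  constructor legal
  field
    bounded  : All (_< k) (vertices s)
    distinct : Unique (vertices s)
    present  : All (λ (i , j) → known P k i j ≡ just true) (edges s)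
    absent   : All (λ (i , j) → known P k i j ≡ just false) (nonedges s)

legal? : ∀ k P s → Dec (Legal k P s)
legal? k P s with All.all? (_<? k) (vertices s) ×-dec unique? ℕ._≟_ (vertices s)
                  ×-dec All.all? (λ (i , j) → known P k i j ≟ᵐ just true) (edges s)
                  ×-dec All.all? (λ (i , j) → known P k i j ≟ᵐ just false) (nonedges s)
... | yes (b , d , p , a) = yes (legal b d p a)
... | no illegal = no λ (legal b d p a) → illegal (b , d , p , a)

step-sound : {G : Cubic n} {f : ℕ → Fin n} {k : ℕ} {P : Picture} → Realises G f k P →
  ∀ s → Legal k P s → Σ (Cubic n) λ G′ → Adjacent G G′ × Realises G′ f k (after s P) × Frame G G′ f k
step-sound {G = G} {f} {k} {P} R (make y x v w z)
  (legal (y< ∷ x< ∷ v< ∷ w< ∷ z< ∷ [])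
         ((y≢x ∷ y≢v ∷ y≢w ∷ y≢z ∷ []) ∷ (x≢v ∷ x≢w ∷ x≢z ∷ []) ∷ (v≢w ∷ v≢z ∷ []) ∷ (w≢z ∷ []) ∷ [] ∷ [])
         (yx ∷ xv ∷ vw ∷ wz ∷ []) (xw ∷ yz ∷ [])) =
  sw G S ,
  inj₁ (f y , f x , f v , f w , f z , inj₁
    ( y≢x ∘ injective R y< x< , y≢v ∘ injective R y< v< , y≢w ∘ injective R y< w< , y≢z ∘ injective R y< z<
    , x≢v ∘ injective R x< v< , x≢w ∘ injective R x< w< , x≢z ∘ injective R x< z<
    , v≢w ∘ injective R v< w< , v≢z ∘ injective R v< z< , w≢z ∘ injective R w< z<
    , known-sound R y< x< yx , known-sound R x< v< xv , known-sound R v< w< vw , known-sound R w< z< wz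
    , false⇒¬true (known-sound R x< w< xw) , false⇒¬true (known-sound R y< z< yz) , λ _ _ → refl)) ,
  sw-realises R x< y< w< z< S , sw-frame G f x< y< w< z< S
  where
  S : Switchable G (f x) (f y) (f w) (f z)
  S = record
    { x≢w = x≢w ∘ injective R x< w< ; x≢z = x≢z ∘ injective R x< z<
    ; y≢w = y≢w ∘ injective R y< w< ; y≢z = y≢z ∘ injective R y< z<
    ; x~y = ~-sym G (known-sound R y< x< yx) ; w~z = known-sound R w< z< wz
    ; x≁w = known-sound R x< w< xw ; y≁z = known-sound R y< z< yz }
step-sound {G = G} {f} {k} {P} R (break v x w y z)
  (legal (v< ∷ x< ∷ w< ∷ y< ∷ z< ∷ [])
         ((v≢x ∷ v≢w ∷ v≢y ∷ v≢z ∷ []) ∷ (x≢w ∷ x≢y ∷ x≢z ∷ []) ∷ (w≢y ∷ w≢z ∷ []) ∷ (y≢z ∷ []) ∷ [] ∷ [])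
         (vx ∷ xw ∷ wv ∷ yz ∷ []) (xy ∷ wz ∷ [])) =
  sw G S ,
  inj₁ (f v , f x , f w , f y , f z , inj₂
    ( known-sound R v< x< vx , known-sound R x< w< xw , known-sound R w< v< wv , known-sound R y< z< yz
    , v≢y ∘ ≡-sym ∘ injective R y< v< , x≢y ∘ ≡-sym ∘ injective R y< x< , w≢y ∘ ≡-sym ∘ injective R y< w<
    , v≢z ∘ ≡-sym ∘ injective R z< v< , x≢z ∘ ≡-sym ∘ injective R z< x< , w≢z ∘ ≡-sym ∘ injective R z< w<
    , false⇒¬true (known-sound R x< y< xy) , false⇒¬true (known-sound R w< z< wz) , λ _ _ → refl)) ,
  sw-realises R x< w< y< z< S , sw-frame G f x< w< y< z< S
  where
  S : Switchable G (f x) (f w) (f y) (f z)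
  S = record
    { x≢w = x≢y ∘ injective R x< y< ; x≢z = x≢z ∘ injective R x< z<
    ; y≢w = w≢y ∘ injective R w< y< ; y≢z = w≢z ∘ injective R w< z<
    ; x~y = known-sound R x< w< xw ; w~z = known-sound R y< z< yz
    ; x≁w = known-sound R x< y< xy ; y≁z = known-sound R w< z< wz }

afters : List Step → Picture → Picture
afters []       P = P
afters (s ∷ ss) P = afters ss (after s P)

Legals : ℕ → Picture → List Step → Set
Legals k P []       = ⊤
Legals k P (s ∷ ss) = Legal k P s × Legals k (after s P) ss

legals? : ∀ k P ss → Dec (Legals k P ss)
legals? k P []       = yes tt
legals? k P (s ∷ ss) = legal? k P s ×-dec legals? k (after s P) ss

steps-sound : {G : Cubic n} {f : ℕ → Fin n} {k : ℕ} {P : Picture} → Realises G f k P →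
  ∀ ss → Legals k P ss → Σ (Cubic n) λ G′ → G ⇝ G′ × Realises G′ f k (afters ss P) × Frame G G′ f k
steps-sound {G = G} R [] _ = G , ⇝-refl , R , λ _ _ _ → refl
steps-sound R (s ∷ ss) (l , ls) =
  let _ , G⇝G₁ , R₁ , F₁ = step-sound R s l
      _ , G₁⇝G₂ , R₂ , F₂ = steps-sound R₁ ss ls
  in _ , ⇝-trans (Adjacent⇒⇝ G⇝G₁) G₁⇝G₂ , R₂ , λ a b out → trans (F₂ a b out) (F₁ a b out)

-- Naming further vertices, and renaming

extend : Picture → ℕ → (ℕ → Maybe Bool) → Picture
extend P k row a b =
  if a ≡ᵇ k then (if b ≡ᵇ k then nothing else row b)
  else (if b ≡ᵇ k then row a else P a b)

_[_↦_] : {A : Set} → (ℕ → A) → ℕ → A → ℕ → A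
(f [ k ↦ u ]) a = if a ≡ᵇ k then u else f a

<suc∧≢⇒< : ∀ {a k} → a < suc k → a ≢ k → a < k
<suc∧≢⇒< a< a≢k = ≤∧≢⇒< (s≤s⁻¹ a<) a≢k

extend-realises : {G : Cubic n} {f : ℕ → Fin n} {k : ℕ} {P : Picture} → Realises G f k P →
  ∀ {u} row → (∀ {i} → i < k → u ≢ f i) → (∀ {i b} → i < k → row i ≡ just b → adj G u (f i) ≡ b) →
  Realises G (f [ k ↦ u ]) (suc k) (extend P k row)
extend-realises {k = k} R row u∉ row-sound .injective {i} {j} i< j< e with i ≡ᵇ k in ik | j ≡ᵇ k in jk
... | true  | true  = trans (≡ᵇ-true⁻ ik) (≡-sym (≡ᵇ-true⁻ jk))
... | true  | false = contradiction e (u∉ (<suc∧≢⇒< j< (≡ᵇ-false⁻ jk)))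
... | false | true  = contradiction (≡-sym e) (u∉ (<suc∧≢⇒< i< (≡ᵇ-false⁻ ik)))
... | false | false = injective R (<suc∧≢⇒< i< (≡ᵇ-false⁻ ik)) (<suc∧≢⇒< j< (≡ᵇ-false⁻ jk)) e
extend-realises {G = G} {k = k} R row u∉ row-sound .sound {i} {j} i< j< e with i ≡ᵇ k in ik | j ≡ᵇ k in jk
extend-realises R row u∉ row-sound .sound i< j< () | true | true
... | true  | false = row-sound (<suc∧≢⇒< j< (≡ᵇ-false⁻ jk)) e
... | false | true  = trans (Defs.sym G _ _) (row-sound (<suc∧≢⇒< i< (≡ᵇ-false⁻ ik)) e)
... | false | false = sound R (<suc∧≢⇒< i< (≡ᵇ-false⁻ ik)) (<suc∧≢⇒< j< (≡ᵇ-false⁻ jk)) e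

unknown : ℕ → Maybe Bool
unknown _ = nothing

only : ℕ → ℕ → Maybe Bool
only i j = if j ≡ᵇ i then just true else nothing

-- If all adjacencies of i to named vertices are decided and fewer than three are present, a missing
-- neighbour must be a vertex not yet named.
Growable : Picture → ℕ → ℕ → Set
Growable P k i = i < k × length (seen P k i) < 3 ×
  All (λ j → P i j ≡ just true ⊎ known P k i j ≡ just false) (upTo k)

growable? : ∀ P k i → Dec (Growable P k i)
growable? P k i = i <? k ×-dec length (seen P k i) <? 3 ×-dec
  All.all? (λ j → (P i j ≟ᵐ just true) ⊎-dec (known P k i j ≟ᵐ just false)) (upTo k)

grow-realises : {G : Cubic n} {f : ℕ → Fin n} {k : ℕ} {P : Picture} → Realises G f k P →
  ∀ i → Growable P k i →
  ∃ λ u → (∀ {j} → j < k → u ≢ f j) × Realises G (f [ k ↦ u ]) (suc k) (extend P k (only i))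
grow-realises {G = G} {f} {k} {P} R i (i<k , few , decided)
  with ∃-outside {p = adj G (f i)} (map f (seen P k i))
         (subst (suc (length (map f (seen P k i))) ≤_) (≡-sym (count-adj G (f i)))
           (subst (λ l → suc l ≤ 3) (≡-sym (length-map f (seen P k i))) few))
... | u , fi~u , u∉seen = u , u∉ , extend-realises R (only i) u∉ row-sound
  where
  u∉ : ∀ {j} → j < k → u ≢ f j
  u∉ {j} j<k refl with All.lookup decided (∈-upTo⁺ j<k)
  ... | inj₁ Pij = u∉seen (∈-map⁺ f (seen⁺ P j<k Pij))
  ... | inj₂ Kij = false⇒¬true (known-sound R i<k j<k Kij) fi~u
  row-sound : ∀ {j b} → j < k → only i j ≡ just b → adj G u (f j) ≡ b
  row-sound {j} _ e with j ≡ᵇ i in ji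
  row-sound {j} _ refl | true with ≡ᵇ-true⁻ {j} ji
  ... | refl = ~-sym G fi~u

Selects : (ℕ → ℕ) → ℕ → Picture → ℕ → Picture → Set
Selects g k P m Q = All (λ i → g i < k × All (λ j → (g i ≡ g j → i ≡ j) ×
  (Q i j ≡ nothing ⊎ known P k (g i) (g j) ≡ Q i j)) (upTo m)) (upTo m)

selects? : ∀ g k P m Q → Dec (Selects g k P m Q)
selects? g k P m Q = All.all? (λ i → g i <? k ×-dec All.all? (λ j → (g i ℕ.≟ g j →-dec i ℕ.≟ j) ×-dec
  ((Q i j ≟ᵐ nothing) ⊎-dec (known P k (g i) (g j) ≟ᵐ Q i j))) (upTo m)) (upTo m)

select-realises : {G : Cubic n} {f : ℕ → Fin n} {k : ℕ} {P : Picture} → Realises G f k P →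
  ∀ g {m Q} → Selects g k P m Q → Realises G (f ∘ g) m Q
select-realises R g sel .injective i<m j<m e =
  let gi< , row = All.lookup sel (∈-upTo⁺ i<m)
      gj< , _   = All.lookup sel (∈-upTo⁺ j<m)
  in proj₁ (All.lookup row (∈-upTo⁺ j<m)) (injective R gi< gj< e)
select-realises R g sel .sound i<m j<m e
  with All.lookup sel (∈-upTo⁺ i<m) | All.lookup sel (∈-upTo⁺ j<m)
... | gi< , row | gj< , _ with proj₂ (All.lookup row (∈-upTo⁺ j<m))
...   | inj₂ K = known-sound R gi< gj< (trans K e)
...   | inj₁ N with trans (≡-sym N) e
...     | ()

fresh-vertex : ∀ {k} → k < n → (f : ℕ → Fin n) → ∃ λ u → ∀ {i} → i < k → u ≢ f i
fresh-vertex {n} {k} k<n f =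
  let u , _ , u∉ = ∃-outside {p = const true} (map f (upTo k))
                     (≤-<-trans (≤-reflexive (trans (length-map f (upTo k)) (length-upTo k))) (≤-trans k<n n≤))
  in u , λ i<k u≡fi → u∉ (subst (_∈ map f (upTo k)) (≡-sym u≡fi) (∈-map⁺ f (∈-upTo⁺ i<k)))
  where
  n≤ : n ≤ count {n} (const true)
  n≤ = subst (_≤ count {n} (const true)) (length-tabulate id)
         (unique-members⇒length-≤ (Unique.allFin⁺ n) (λ _ → refl))

-- A strategy under partial knowledge: branch on an adjacency, name by the next index k a further neighbour of i
-- or a vertex not yet named, play moves, and finally list the vertices that realise the target picture.
data Plan : Set where
  split : (i j : ℕ) (adjacent nonadjacent : Plan) → Plan
  grow  : (i : ℕ) → Plan → Plan
  fresh : Plan → Plan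
  play  : List Step → Plan → Plan
  goal  : List ℕ → Plan

nth : List ℕ → ℕ → ℕ
nth []       _       = 0
nth (a ∷ as) zero    = a
nth (a ∷ as) (suc i) = nth as i

module _ (m : ℕ) (Q : Picture) where

  Valid : ℕ → Picture → Plan → Set
  Valid k P (split i j p q) = i < k × j < k × Valid k (P [ i , j ≔ true ]) p × Valid k (P [ i , j ≔ false ]) q
  Valid k P (grow i p)      = Growable P k i × Valid (suc k) (extend P k (only i)) p
  -- The constant is the bound 8 ≤ n of `plan-sound`: some vertex is still without a name.
  Valid k P (fresh p)       = k < 8 × Valid (suc k) (extend P k unknown) p
  Valid k P (play ss p)     = Legals k P ss × Valid k (afters ss P) p
  Valid k P (goal is)       = Selects (nth is) k P m Q

  valid? : ∀ k P p → Dec (Valid k P p)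
  valid? k P (split i j p q) = i <? k ×-dec j <? k ×-dec valid? k (P [ i , j ≔ true ]) p ×-dec valid? k (P [ i , j ≔ false ]) q
  valid? k P (grow i p)      = growable? P k i ×-dec valid? (suc k) (extend P k (only i)) p
  valid? k P (fresh p)       = k <? 8 ×-dec valid? (suc k) (extend P k unknown) p
  valid? k P (play ss p)     = legals? k P ss ×-dec valid? k (afters ss P) p
  valid? k P (goal is)       = selects? (nth is) k P m Q

  Attains : Cubic n → Set
  Attains G = Σ (Cubic _) λ G′ → G ⇝ G′ × ∃ λ f → Realises G′ f m Q

  plan-sound : 8 ≤ n → {G : Cubic n} {f : ℕ → Fin n} {k : ℕ} {P : Picture} → Realises G f k P →
               ∀ p → Valid k P p → Attains G
  plan-sound 8≤n {G} {f} R (split i j p q) (i< , j< , vp , vq) with adj G (f i) (f j) in e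
  ... | true  = plan-sound 8≤n (assign R i< j< e) p vp
  ... | false = plan-sound 8≤n (assign R i< j< e) q vq
  plan-sound 8≤n R (grow i p) (g , v) =
    let _ , _ , R′ = grow-realises R i g in plan-sound 8≤n R′ p v
  plan-sound 8≤n {f = f} R (fresh p) (k<8 , v) =
    let _ , u∉ = fresh-vertex (≤-trans k<8 8≤n) f in plan-sound 8≤n (extend-realises R unknown u∉ λ _ ()) p v
  plan-sound 8≤n R (play ss p) (ls , v) =
    let _ , G⇝G₁ , R₁ , _ = steps-sound R ss ls
        G₂ , G₁⇝G₂ , R₂ = plan-sound 8≤n R₁ p v
    in G₂ , ⇝-trans G⇝G₁ G₁⇝G₂ , R₂
  plan-sound 8≤n {G} {f} R (goal is) sel = G , ⇝-refl , f ∘ nth is , select-realises R (nth is) sel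

-- Cut off at 1, 3 and 4 indices this is a lone vertex, a triangle and a K₄. The diagonal may stay
-- open because `known` fills it in.
complete : Picture
complete i j = if i ≡ᵇ j then nothing else just true

-- The tips 2 and 3 are left undecided, so a K₄ also qualifies.
diamond : Picture
diamond i j = if same i j 2 3 then nothing else complete i j

-- Reaching a K₄

-- A `make` on a path turns its three middle vertices into a triangle, provided that the ends, and
-- the outer two of the three, are nonadjacent. The path 4, 1, 0, 2, 6 is the default; each short
-- cycle that would spoil a path supplies another one.
triangle-plan : Plan
triangle-plan =
  grow 0 $ grow 0 $ grow 0 $
  split 1 2 (goal (0 ∷ 1 ∷ 2 ∷ [])) $
  split 1 3 (goal (0 ∷ 1 ∷ 3 ∷ [])) $
  grow 1 $ grow 1 $
  split 2 3 (goal (0 ∷ 2 ∷ 3 ∷ [])) $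
  split 2 4 (play (make 3 0 1 4 2 ∷ []) (goal (0 ∷ 1 ∷ 4 ∷ []))) $
  split 2 5 (play (make 3 0 1 5 2 ∷ []) (goal (0 ∷ 1 ∷ 5 ∷ []))) $
  grow 2 $ grow 2 $
  split 3 4 (play (make 2 0 1 4 3 ∷ []) (goal (0 ∷ 1 ∷ 4 ∷ []))) $
  split 3 5 (play (make 2 0 1 5 3 ∷ []) (goal (0 ∷ 1 ∷ 5 ∷ []))) $
  split 3 6 (play (make 1 0 2 6 3 ∷ []) (goal (0 ∷ 2 ∷ 6 ∷ []))) $
  split 3 7 (play (make 1 0 2 7 3 ∷ []) (goal (0 ∷ 2 ∷ 7 ∷ []))) $
  grow 3 $ grow 3 $
  split 4 5 (goal (1 ∷ 4 ∷ 5 ∷ [])) $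
  split 4 6 (play (make 3 0 1 4 6 ∷ []) (goal (0 ∷ 1 ∷ 4 ∷ []))) $
  play (make 4 1 0 2 6 ∷ []) (goal (0 ∷ 1 ∷ 2 ∷ []))

-- The fresh vertex serves the triangular prism; the last branch contains K₃,₃ with one vertex replaced by a triangle.
diamond-plan : Plan
diamond-plan =
  grow 0 $
  split 1 3 (goal (0 ∷ 1 ∷ 2 ∷ 3 ∷ [])) $
  grow 1 $
  split 2 3 (goal (0 ∷ 2 ∷ 1 ∷ 3 ∷ [])) $
  split 2 4 (goal (1 ∷ 2 ∷ 0 ∷ 4 ∷ [])) $
  grow 2 $
  -- The third neighbours 3, 4, 5 of the triangle are now distinct. If one or two of the pairs among
  -- them are adjacent, a single `make` suffices; if all or none are, a `break` has to come first.
  split 3 4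
    (split 3 5
      (split 4 5
        (fresh $ grow 6 $
        play (break 0 1 2 6 7 ∷ make 6 1 0 3 5 ∷ []) (goal (1 ∷ 3 ∷ 0 ∷ 4 ∷ []))) $
      play (make 4 1 0 3 5 ∷ []) (goal (0 ∷ 1 ∷ 2 ∷ 3 ∷ []))) $
    play (make 5 2 1 4 3 ∷ []) (goal (1 ∷ 2 ∷ 0 ∷ 4 ∷ []))) $
  split 3 5 (play (make 4 1 2 5 3 ∷ []) (goal (1 ∷ 2 ∷ 0 ∷ 5 ∷ []))) $
  grow 3 $ grow 3 $
  split 4 5 (play (make 3 0 1 4 5 ∷ []) (goal (0 ∷ 1 ∷ 2 ∷ 4 ∷ []))) $
  play (break 0 1 2 3 6 ∷ make 4 1 0 2 5 ∷ []) (goal (0 ∷ 1 ∷ 2 ∷ 3 ∷ []))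

-- The closing move is a `make` through 2, 0, 3, which joins the tips. It needs the outer neighbours
-- of 2 and 3 to be distinct and nonadjacent; the other branches spend one move on arranging this.
K₄-plan : Plan
K₄-plan =
  split 2 3 (goal (0 ∷ 1 ∷ 2 ∷ 3 ∷ [])) $
  grow 2 $
  split 3 4
    -- The tips share the neighbour 4. A `make` around 5 replaces the edge 24 by one from 2 to a
    -- vertex not adjacent to 4.
    (grow 4 $ grow 5 $ grow 5 $
    split 6 7 (play (make 2 4 5 6 7 ∷ make 7 2 0 3 4 ∷ []) (goal (0 ∷ 1 ∷ 2 ∷ 3 ∷ []))) $
    grow 6 $
    play (make 2 4 5 6 8 ∷ make 8 2 0 3 4 ∷ []) (goal (0 ∷ 1 ∷ 2 ∷ 3 ∷ []))) $
  grow 3 $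
  split 4 5
    -- The outer neighbours 4 and 5 are adjacent. If they lie in a triangle 456, a `break` removes
    -- 45; otherwise a `make` around 4 replaces 35 by an edge from 3 to a vertex not adjacent to 4.
    (grow 4 $
    split 5 6
      (grow 6 $ grow 7 $
      play (break 6 4 5 7 8 ∷ make 4 2 0 3 5 ∷ []) (goal (0 ∷ 1 ∷ 2 ∷ 3 ∷ []))) $
    grow 5 $
    split 6 7 (play (make 3 5 4 6 7 ∷ make 4 2 0 3 7 ∷ []) (goal (0 ∷ 1 ∷ 2 ∷ 3 ∷ []))) $
    grow 6 $
    play (make 3 5 4 6 8 ∷ make 4 2 0 3 8 ∷ []) (goal (0 ∷ 1 ∷ 2 ∷ 3 ∷ []))) $
  play (make 4 2 0 3 5 ∷ []) (goal (0 ∷ 1 ∷ 2 ∷ 3 ∷ []))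

K₄ : Cubic n → (ℕ → Fin n) → Set
K₄ G q = Realises G q 4 complete

single : (G : Cubic n) (v : Fin n) → Realises G (λ _ → v) 1 complete
single G v .injective (s≤s z≤n) (s≤s z≤n) _ = refl
single G v .sound (s≤s z≤n) (s≤s z≤n) ()

attains-K₄ : 8 ≤ n → (G : Cubic n) → Fin n → Attains 4 complete G
attains-K₄ 8≤n G v =
  let G₁ , G⇝G₁ , _ , triangle = plan-sound 3 complete 8≤n (single G v) triangle-plan
                                   (toWitness {a? = valid? 3 complete 1 complete triangle-plan} tt)
      G₂ , G₁⇝G₂ , _ , dia = plan-sound 4 diamond 8≤n triangle diamond-plan
                                   (toWitness {a? = valid? 4 diamond 3 complete diamond-plan} tt)
      G₃ , G₂⇝G₃ , K = plan-sound 4 complete 8≤n dia K₄-plan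
                                   (toWitness {a? = valid? 4 complete 4 diamond K₄-plan} tt)
  in G₃ , ⇝-trans G⇝G₁ (⇝-trans G₁⇝G₂ G₂⇝G₃) , K

-- Moving the K₄ to prescribed vertices

↦-≡ : {A : Set} (f : ℕ → A) (k : ℕ) {u : A} → (f [ k ↦ u ]) k ≡ u
↦-≡ f k with k ≡ᵇ k in e
... | true  = refl
... | false = contradiction refl (≡ᵇ-false⁻ {k} e)

↦-≢ : {A : Set} (f : ℕ → A) {i k : ℕ} {u : A} → i ≢ k → (f [ k ↦ u ]) i ≡ f i
↦-≢ f {i} {k} i≢k with i ≡ᵇ k in e
... | true  = contradiction (≡ᵇ-true⁻ e) i≢k
... | false = refl

Outside : (ℕ → Fin n) → ℕ → Fin n → Set
Outside f k u = ∀ {i} → i < k → u ≢ f i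

outside-↦ : {f : ℕ → Fin n} {k : ℕ} {u v : Fin n} → Outside f k u → u ≢ v → Outside (f [ k ↦ v ]) (suc k) u
outside-↦ {k = k} u∉ u≢v {i} i< with i ≡ᵇ k in e
... | true  = u≢v
... | false = u∉ (<suc∧≢⇒< i< (≡ᵇ-false⁻ e))

outside? : (f : ℕ → Fin n) (k : ℕ) (u : Fin n) → (∃ λ i → i < k × u ≡ f i) ⊎ Outside f k u
outside? f k u with any? (λ i → u ≟ f i) (upTo k)
... | yes found = let i , i∈ , u≡fi = find found in inj₁ (i , ∈-upTo⁻ i∈ , u≡fi)
... | no none   = inj₂ λ i<k u≡fi → none (lose (∈-upTo⁺ i<k) u≡fi)

below-4 : ∀ {i} → i < 4 → ∀ d → i < 4 + d
below-4 i<4 d = ≤-trans i<4 (m≤m+n 4 d)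

-- The row of 4 can start as `unknown`: the vertices of the K₄ are saturated, so 4 is known to have
-- all three neighbours elsewhere.
pendant : ℕ → Picture
pendant zero    = extend complete 4 unknown
pendant (suc d) = extend (pendant d) (5 + d) (only 4)

-- Vertex 4 and its neighbours 5, 6, 7 lie off the K₄ on 0, …, 3; each move hands one neighbour of 4 over to j.
replacement : ℕ → List Step
replacement j = break b j a 5 4 ∷ break c j b 6 4 ∷ make j c a 4 7 ∷ []
  where
  a b c : ℕ
  a = (1 + j) % 4
  b = (2 + j) % 4
  c = (3 + j) % 4

replaceable : All (λ j → Legals 8 (pendant 3) (replacement j) ×
                         Selects (id [ j ↦ 4 ]) 8 (afters (replacement j) (pendant 3)) 4 complete) (upTo 4)
replaceable = toWitness {a? = All.all? (λ j → legals? 8 (pendant 3) (replacement j) ×-dec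
  selects? (id [ j ↦ 4 ]) 8 (afters (replacement j) (pendant 3)) 4 complete) (upTo 4)} tt

replace : {G : Cubic n} {q : ℕ → Fin n} → K₄ G q → ∀ {r} → Outside q 4 r → ∀ {j} → j < 4 →
  Σ (Cubic n) λ G′ → G ⇝ G′ × ∃ λ q′ → K₄ G′ q′ × q′ j ≡ r × (∀ {i} → i < 4 → i ≢ j → q′ i ≡ q i)
replace {q = q} K {r} r∉ {j} j<4 =
  let u , _ , R₆ = grow-realises (extend-realises K unknown r∉ λ _ ()) 4 (toWitness {a? = growable? (pendant 0) 5 4} tt)
      v , _ , R₇ = grow-realises R₆ 4 (toWitness {a? = growable? (pendant 1) 6 4} tt)
      w , _ , R₈ = grow-realises R₇ 4 (toWitness {a? = growable? (pendant 2) 7 4} tt)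
      ls , sel   = All.lookup replaceable (∈-upTo⁺ j<4)
      G′ , G⇝G′ , R′ , _ = steps-sound R₈ (replacement j) ls
      f₅ = q [ 4 ↦ r ]
      f₆ = f₅ [ 5 ↦ u ]
      f₇ = f₆ [ 6 ↦ v ]
      f₈ = f₇ [ 7 ↦ w ]
      old : ∀ {i} → i < 4 → f₈ i ≡ q i
      old i<4 = trans (↦-≢ f₇ (<⇒≢ (below-4 i<4 3))) (trans (↦-≢ f₆ (<⇒≢ (below-4 i<4 2)))
                  (trans (↦-≢ f₅ (<⇒≢ (below-4 i<4 1))) (↦-≢ q (<⇒≢ i<4))))
  in G′ , G⇝G′ , f₈ ∘ (id [ j ↦ 4 ]) , select-realises R′ (id [ j ↦ 4 ]) sel ,
     cong f₈ (↦-≡ id j) , λ i<4 i≢j → trans (cong f₈ (↦-≢ id i≢j)) (old i<4)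

interchange : ℕ → ℕ → ℕ → ℕ
interchange i j = (id [ j ↦ i ]) [ i ↦ j ]

interchangeable : All (λ i → All (λ j → Selects (interchange i j) 4 complete 4 complete) (upTo 4)) (upTo 4)
interchangeable = toWitness {a? = All.all? (λ i → All.all? (λ j → selects? (interchange i j) 4 complete 4 complete)
  (upTo 4)) (upTo 4)} tt

interchange-right : ∀ i j → interchange i j j ≡ i
interchange-right i j with j ℕ.≟ i
... | yes refl = ↦-≡ (id [ j ↦ i ]) i
... | no j≢i   = trans (↦-≢ (id [ j ↦ i ]) j≢i) (↦-≡ id j)

-- Indices are treated one at a time. If `t j` is already on the K₄ two labels are interchanged,
-- otherwise it is brought in by `replace`. Injectivity of `t` keeps the interchange away from the
-- indices already placed.
relocate : {G : Cubic n} {q t : ℕ → Fin n} → K₄ G q → (∀ {i j} → i < 4 → j < 4 → t i ≡ t j → i ≡ j) → ∀ j → j ≤ 4 →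
  Σ (Cubic n) λ G′ → G ⇝ G′ × ∃ λ q′ → K₄ G′ q′ × (∀ {i} → i < j → q′ i ≡ t i)
relocate {G = G} {q} K _ zero _ = G , ⇝-refl , q , K , λ ()
relocate {t = t} K t-injective (suc j) j<4 with relocate {t = t} K t-injective j (<⇒≤ j<4)
... | G′ , G⇝G′ , q′ , K′ , placed with outside? q′ 4 (t j)
...   | inj₁ (i , i<4 , tj≡q′i) =
  G′ , G⇝G′ , q′ ∘ interchange i j ,
  select-realises K′ (interchange i j) (All.lookup (All.lookup interchangeable (∈-upTo⁺ i<4)) (∈-upTo⁺ j<4)) , placed′
  where
  placed′ : ∀ {l} → l < suc j → q′ (interchange i j l) ≡ t l
  placed′ {l} l≤j with l ℕ.≟ j
  ... | yes refl = trans (cong q′ (interchange-right i j)) (≡-sym tj≡q′i)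
  ... | no l≢j = trans (cong q′ (trans (↦-≢ (id [ j ↦ i ]) l≢i) (↦-≢ id l≢j))) (placed l<j)
    where
    l<j : l < j
    l<j = <suc∧≢⇒< l≤j l≢j
    l≢i : l ≢ i
    l≢i refl = l≢j (t-injective (<-trans l<j j<4) j<4 (trans (≡-sym (placed l<j)) (≡-sym tj≡q′i)))
...   | inj₂ tj∉ =
  let G″ , G′⇝G″ , q″ , K″ , at-j , rest = replace K′ tj∉ j<4
  in G″ , ⇝-trans G⇝G′ G′⇝G″ , q″ , K″ , λ {l} l≤j → placed′ q″ at-j rest l≤j
  where
  placed′ : ∀ q″ → q″ j ≡ t j → (∀ {i} → i < 4 → i ≢ j → q″ i ≡ q′ i) → ∀ {l} → l < suc j → q″ l ≡ t l
  placed′ q″ at-j rest {l} l≤j with l ℕ.≟ j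
  ... | yes refl = at-j
  ... | no l≢j = let l<j = <suc∧≢⇒< l≤j l≢j in trans (rest (<-trans l<j j<4) l≢j) (placed l<j)

realises-cong : {G : Cubic n} {f g : ℕ → Fin n} {k : ℕ} {P : Picture} →
                Realises G f k P → (∀ {i} → i < k → f i ≡ g i) → Realises G g k P
realises-cong R f≗g .injective i<k j<k e = injective R i<k j<k (trans (f≗g i<k) (trans e (≡-sym (f≗g j<k))))
realises-cong {G = G} R f≗g .sound i<k j<k e rewrite ≡-sym (f≗g i<k) | ≡-sym (f≗g j<k) = sound R i<k j<k e

-- Simulating an arbitrary switch next to a K₄

Settled : ℕ → Picture → Picture → Set
Settled k P Q = All (λ i → All (λ j → known P k i j ≡ known Q k i j × known P k i j ≢ nothing) (upTo k)) (upTo k)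

settled? : ∀ k P Q → Dec (Settled k P Q)
settled? k P Q = All.all? (λ i → All.all? (λ j → (known P k i j ≟ᵐ known Q k i j) ×-dec ¬? (known P k i j ≟ᵐ nothing))
  (upTo k)) (upTo k)

settled⇒same : {G G₁ G₂ : Cubic n} {f : ℕ → Fin n} {k : ℕ} {P Q : Picture} →
  Realises G₁ f k P → Frame G G₁ f k → Realises G₂ f k Q → Frame G G₂ f k → Settled k P Q → SameGraph G₁ G₂
settled⇒same {G₁ = G₁} {G₂} {f} {k} {P} R₁ F₁ R₂ F₂ settled a b with outside? f k a | outside? f k b
... | inj₂ a∉ | _ = trans (F₁ a b (inj₁ a∉)) (≡-sym (F₂ a b (inj₁ a∉)))
... | inj₁ _ | inj₂ b∉ = trans (F₁ a b (inj₂ b∉)) (≡-sym (F₂ a b (inj₂ b∉)))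
... | inj₁ (i , i<k , refl) | inj₁ (j , j<k , refl) with All.lookup (All.lookup settled (∈-upTo⁺ i<k)) (∈-upTo⁺ j<k)
...   | P≡Q , P≢nothing with known P k i j in e
...     | just c  = trans (known-sound R₁ i<k j<k e) (≡-sym (known-sound R₂ i<k j<k (≡-sym P≡Q)))
...     | nothing = contradiction refl P≢nothing

sw-K₄ : {G : Cubic n} {q : ℕ → Fin n} {x y w z : Fin n} → K₄ G q → (S : Switchable G x y w z) →
  Outside q 4 x → Outside q 4 y → Outside q 4 w → Outside q 4 z → K₄ (sw G S) q
sw-K₄ K S x∉ y∉ w∉ z∉ .injective = injective K
sw-K₄ {G = G} K S x∉ y∉ w∉ z∉ .sound i<4 j<4 e =
  trans (switched-row-other G S (x∉ i<4 ∘ ≡-sym) (y∉ i<4 ∘ ≡-sym) (w∉ i<4 ∘ ≡-sym) (z∉ i<4 ∘ ≡-sym) _) (sound K i<4 j<4 e)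

-- The switch 45, 67 ↦ 46, 57 with a K₄ on 0, …, 3: whether 5 ~ 6 and 4 ~ 7 is immaterial, and so a parameter.
row-w : Bool → ℕ → Maybe Bool
row-w yw j = if j ≡ᵇ 4 then just false else if j ≡ᵇ 5 then just yw else nothing

row-z : Bool → ℕ → Maybe Bool
row-z xz j = if j ≡ᵇ 4 then just xz else if j ≡ᵇ 5 then just false else if j ≡ᵇ 6 then just true else nothing

before : Bool → Bool → Picture
before yw xz = extend (extend (extend (extend complete 4 unknown) 5 (only 4)) 6 (row-w yw)) 7 (row-z xz)

-- The first break splices the K₄ into 45 as a diamond and the second opens the diamond along 67, leaving the
-- triangle 123 and the vertex 0.  The four loose ends are now joined up in the other way.
simulation : List Step
simulation = break 2 0 1 4 5 ∷ break 2 0 3 7 6 ∷ make 4 0 2 3 6 ∷ make 7 0 2 1 5 ∷ []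

Simulates : Bool → Bool → Set
Simulates yw xz = Legals 8 (before yw xz) simulation ×
                  Settled 8 (afters simulation (before yw xz)) (swap (before yw xz) 4 5 6 7)

simulates? : ∀ yw xz → Dec (Simulates yw xz)
simulates? yw xz = legals? 8 (before yw xz) simulation ×-dec
                   settled? 8 (afters simulation (before yw xz)) (swap (before yw xz) 4 5 6 7)

simulates : ∀ yw xz → Simulates yw xz
simulates false false = toWitness {a? = simulates? false false} tt
simulates false true  = toWitness {a? = simulates? false true} tt
simulates true  false = toWitness {a? = simulates? true false} tt
simulates true  true  = toWitness {a? = simulates? true true} tt

simulate : {G : Cubic n} {q : ℕ → Fin n} {x y w z : Fin n} → K₄ G q → (S : Switchable G x y w z) →
  Outside q 4 x → Outside q 4 y → Outside q 4 w → Outside q 4 z → G ⇝ sw G S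
simulate {G = G} {q} {x} {y} {w} {z} K S x∉ y∉ w∉ z∉ =
  let ls , settled = simulates (adj G w y) (adj G z x)
      G′ , G⇝G′ , R′ , F′ = steps-sound R₈ simulation ls
  in ⇝-trans G⇝G′ (⇝-reflexive (settled⇒same {G = G} {G′} {sw G S} R′ F′
       (sw-realises R₈ 4<8 5<8 6<8 7<8 S) (sw-frame G f₈ 4<8 5<8 6<8 7<8 S) settled))
  where
  open Switchable S
  4<8 : 4 < 8
  4<8 = m≤m+n 5 3
  5<8 : 5 < 8
  5<8 = m≤m+n 6 2
  6<8 : 6 < 8
  6<8 = m≤m+n 7 1
  7<8 : 7 < 8
  7<8 = m≤m+n 8 0
  f₈ : ℕ → Fin _
  f₈ = q [ 4 ↦ x ] [ 5 ↦ y ] [ 6 ↦ w ] [ 7 ↦ z ]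
  only-x : ∀ {i b} → i < 5 → only 4 i ≡ just b → adj G y ((q [ 4 ↦ x ]) i) ≡ b
  only-x {i} i< e with i ≡ᵇ 4
  only-x _ refl | true = ~-sym G x~y
  row-w-sound : ∀ {i b} → i < 6 → row-w (adj G w y) i ≡ just b → adj G w ((q [ 4 ↦ x ] [ 5 ↦ y ]) i) ≡ b
  row-w-sound {i} i< e with i ≡ᵇ 4 in e₄ | i ≡ᵇ 5 in e₅
  row-w-sound {i} _ refl | true | true with trans (≡-sym (≡ᵇ-true⁻ {i} e₄)) (≡ᵇ-true⁻ {i} e₅)
  ... | ()
  row-w-sound _ refl | true  | false = ≁-sym G x≁w
  row-w-sound _ refl | false | true  = refl
  row-z-sound : ∀ {i b} → i < 7 → row-z (adj G z x) i ≡ just b → adj G z ((q [ 4 ↦ x ] [ 5 ↦ y ] [ 6 ↦ w ]) i) ≡ b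
  row-z-sound {i} i< e with i ℕ.≟ 4 | i ℕ.≟ 5 | i ℕ.≟ 6
  row-z-sound _ refl | yes refl | _ | _ = refl
  row-z-sound _ refl | _ | yes refl | _ = ≁-sym G y≁z
  row-z-sound _ refl | _ | _ | yes refl = ~-sym G w~z
  row-z-sound {i} _ e | no i≢4 | no i≢5 | no i≢6 with i ≡ᵇ 4 in e₄ | i ≡ᵇ 5 in e₅ | i ≡ᵇ 6 in e₆
  ... | true | _ | _ = contradiction (≡ᵇ-true⁻ e₄) i≢4
  ... | _ | true | _ = contradiction (≡ᵇ-true⁻ e₅) i≢5
  ... | _ | _ | true = contradiction (≡ᵇ-true⁻ e₆) i≢6
  row-z-sound {i} _ () | no i≢4 | no i≢5 | no i≢6 | false | false | false
  R₈ : Realises G f₈ 8 (before (adj G w y) (adj G z x))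
  R₈ = extend-realises
         (extend-realises
           (extend-realises
             (extend-realises K unknown x∉ λ _ ())
             (only 4) (outside-↦ y∉ (~⇒≢ G x~y ∘ ≡-sym)) only-x)
           (row-w (adj G w y)) (outside-↦ (outside-↦ w∉ (x≢w ∘ ≡-sym)) (y≢w ∘ ≡-sym)) row-w-sound)
         (row-z (adj G z x))
         (outside-↦ (outside-↦ (outside-↦ z∉ (x≢z ∘ ≡-sym)) (y≢z ∘ ≡-sym)) (~⇒≢ G w~z ∘ ≡-sym)) row-z-sound

-- Taylor's argument

_∈?_ : (u : Fin n) (us : List (Fin n)) → Dec (u ∈ us)
_∈?_ = member? _≟_

Agree : List (Fin n) → Cubic n → Cubic n → Set
Agree us G H = ∀ {u} → u ∈ us → ∀ w → adj G u w ≡ adj H u w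

Agree-sym : {us : List (Fin n)} {G H : Cubic n} → Agree us G H → Agree us H G
Agree-sym agree u∈ w = ≡-sym (agree u∈ w)

agree-column : {us : List (Fin n)} {G H : Cubic n} → Agree us G H → ∀ w {u} → u ∈ us → adj G w u ≡ adj H w u
agree-column {G = G} {H} agree w u∈ = trans (Defs.sym G _ _) (trans (agree u∈ w) (Defs.sym H _ _))

disagreement : Cubic n → Cubic n → Fin n → ℕ
disagreement G H v = count λ u → adj G v u xor adj H v u

new-neighbour : List (Fin n) → Cubic n → Fin n → Fin n → Bool
new-neighbour us G b u = not ⌊ u ∈? us ⌋ ∧ adj G b u

new-neighbour⁺ : ∀ {us} {G : Cubic n} {b u} → u ∉ us → adj G b u ≡ true → new-neighbour us G b u ≡ true
new-neighbour⁺ {us = us} {u = u} u∉ b~u with u ∈? us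
... | yes u∈ = contradiction u∈ u∉
... | no _   = b~u

new-neighbour⁻ : ∀ {us} {G : Cubic n} {b u} → new-neighbour us G b u ≡ true → u ∉ us × adj G b u ≡ true
new-neighbour⁻ {us = us} {u = u} e with u ∈? us
new-neighbour⁻ () | yes _
new-neighbour⁻ e  | no u∉ = u∉ , e

-- Both degrees are 3, and by symmetry of adjacency the neighbours inside `us` coincide; subtract
-- them.
new-neighbour-count : ∀ {us} {G H : Cubic n} → Agree us G H → ∀ b →
                      count (new-neighbour us G b) ≡ count (new-neighbour us H b)
new-neighbour-count {us = us} {G} {H} agree b = +-cancelˡ-≡ (count (old G)) _ _ (trans (total G)
  (trans (≡-sym (total H)) (cong (_+ count (new-neighbour us H b)) (count-cong (≡-sym ∘ old≗)))))
  where
  old : Cubic _ → Fin _ → Bool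
  old K u = ⌊ u ∈? us ⌋ ∧ adj K b u
  total : ∀ K → count (old K) + count (new-neighbour us K b) ≡ 3
  total K = trans (count-split (λ u → ⌊ u ∈? us ⌋) (adj K b)) (count-adj K b)
  old≗ : ∀ u → old G u ≡ old H u
  old≗ u with u ∈? us
  ... | yes u∈ = agree-column {G = G} {H} agree b u∈
  ... | no _   = refl

-- Transposing a and b embeds the new neighbours of b into those of a, and misses v.
surplus : ∀ {us} (G : Cubic n) {v a b} → v ∉ us → b ∉ us → v ≢ b → adj G v a ≡ true → adj G v b ≡ false →
  (∀ {c} → c ∉ us → adj G b c ≡ true → c ≢ a → adj G a c ≡ true) →
  count (new-neighbour us G b) < count (new-neighbour us G a)
surplus {us = us} G {v} {a} {b} v∉ b∉ v≢b v~a v≁b sub =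
  count-< (transpose a b) (transpose-injective a b) mapped v (new-neighbour⁺ {G = G} v∉ (~-sym G v~a)) missed
  where
  image : ∀ {u} → u ∉ us → adj G b u ≡ true → Dec (u ≡ a) → new-neighbour us G a (transpose a b u) ≡ true
  image u∉ b~u (yes refl) rewrite transpose-left a b = new-neighbour⁺ {G = G} b∉ (~-sym G b~u)
  image {u} u∉ b~u (no u≢a) rewrite transpose-other a b u≢a (~⇒≢ G b~u ∘ ≡-sym) =
    new-neighbour⁺ {G = G} u∉ (sub u∉ b~u u≢a)
  mapped : ∀ u → new-neighbour us G b u ≡ true → new-neighbour us G a (transpose a b u) ≡ true
  mapped u e = let u∉ , b~u = new-neighbour⁻ {us = us} {G} e in image u∉ b~u (u ≟ a)
  missed : ∀ u → new-neighbour us G b u ≡ true → transpose a b u ≢ v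
  missed u e πu≡v with transpose-injective a b {u} {v} (trans πu≡v (≡-sym (transpose-other a b (~⇒≢ G v~a) v≢b)))
  ... | refl = false⇒¬true v≁b (~-sym G (proj₂ (new-neighbour⁻ {us = us} {G} e)))

record Progress (us : List (Fin n)) (q : ℕ → Fin n) (v : Fin n) (G H : Cubic n) : Set where
  field
    G′     : Cubic n
    G⇝G′   : G ⇝ G′
    K₄-G′  : K₄ G′ q
    agree  : Agree us G′ H
    closer : disagreement G′ H v < disagreement G H v

-- The switch trades va, bc for vb, ac: v gives up a neighbour it lacks in `H` for one it has there.
-- All four vertices are outside `us`, so the K₄ and the settled rows survive.
progress : ∀ {us} {q : ℕ → Fin n} (G H : Cubic n) {v a b c} → (∀ {i} → i < 4 → q i ∈ us) → K₄ G q → Agree us G H →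
  v ∉ us → a ∉ us → b ∉ us → c ∉ us →
  adj G v a ≡ true → adj H v a ≡ false → adj H v b ≡ true → adj G v b ≡ false →
  adj G b c ≡ true → adj G a c ≡ false → c ≢ a → Progress us q v G H
progress {us = us} {q} G H {v} {a} {b} {c} q∈ K agree v∉ a∉ b∉ c∉ Gva Hva Hvb Gvb Gbc Gac c≢a = record
  { G′     = sw G S
  ; G⇝G′   = simulate K S (out v∉) (out a∉) (out b∉) (out c∉)
  ; K₄-G′  = sw-K₄ K S (out v∉) (out a∉) (out b∉) (out c∉)
  ; agree  = λ u∈ w → trans (switched-row-other G S (apart u∈ v∉) (apart u∈ a∉) (apart u∈ b∉) (apart u∈ c∉) w) (agree u∈ w)
  ; closer = count-< id id (λ u e → proj₁ (still u e (u ≟ a) (u ≟ b))) a (cong₂ _xor_ Gva Hva)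
                     (λ u e → proj₂ (still u e (u ≟ a) (u ≟ b)))
  }
  where
  out : ∀ {u} → u ∉ us → Outside q 4 u
  out u∉ i<4 u≡qi = u∉ (subst (_∈ us) (≡-sym u≡qi) (q∈ i<4))
  apart : ∀ {u w} → u ∈ us → w ∉ us → u ≢ w
  apart u∈ w∉ refl = w∉ u∈
  S : Switchable G v a b c
  S = record
    { x≢w = ~⇒≢ H Hvb
    ; x≢z = λ { refl → false⇒¬true Gvb (~-sym G Gbc) }
    ; y≢w = λ { refl → false⇒¬true Gvb Gva }
    ; y≢z = c≢a ∘ ≡-sym
    ; x~y = Gva
    ; w~z = Gbc
    ; x≁w = Gvb
    ; y≁z = Gac
    }
  row : ∀ {u u′} → transpose a b u ≡ u′ → adj (sw G S) v u ≡ adj G v u′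
  row {u} e = trans (switched-row-x G S u) (cong (adj G v) e)
  still : ∀ u → adj (sw G S) v u xor adj H v u ≡ true → Dec (u ≡ a) → Dec (u ≡ b) →
          adj G v u xor adj H v u ≡ true × u ≢ a
  still u e (yes refl) _ = contradiction e (false⇒¬true (cong₂ _xor_ (trans (row (transpose-left a b)) Gvb) Hva))
  still u e (no _) (yes refl) = contradiction e (false⇒¬true (cong₂ _xor_ (trans (row (transpose-right a b)) Gva) Hvb))
  still u e (no u≢a) (no u≢b) = trans (cong (_xor adj H v u) (≡-sym (row (transpose-other a b u≢a u≢b)))) e , u≢a

-- Containment is enough because both rows have three entries.
row-⊆⇒≡ : (G H : Cubic n) (v : Fin n) → (∀ u → adj G v u ≡ true → adj H v u ≡ true) → ∀ u → adj G v u ≡ adj H v u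
row-⊆⇒≡ G H v sub u with adj G v u in Gvu | adj H v u in Hvu
... | true  | true  = refl
... | false | false = refl
... | true  | false = contradiction (sub u Gvu) (false⇒¬true Hvu)
... | false | true  = contradiction
  (subst₂ _<_ (count-adj G v) (count-adj H v)
    (count-< id id sub u Hvu λ { w Gvw refl → false⇒¬true Gvu Gvw }))
  (<-irrefl refl)

difference? : (G H : Cubic n) (v : Fin n) →
  (∃ λ a → adj G v a ≡ true × adj H v a ≡ false) ⊎ (∀ u → adj G v u ≡ adj H v u)
difference? G H v with Fin.any? (λ a → adj G v a Bool.≟ true ×-dec adj H v a Bool.≟ false)
... | yes found = inj₁ found
... | no none   = inj₂ (row-⊆⇒≡ G H v λ u Gvu → decidable-stable (adj H v u Bool.≟ true)
                          λ ¬Hvu → none (u , Gvu , ¬true⇒false ¬Hvu))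

detour? : ∀ us (G : Cubic n) a b →
  (∃ λ c → c ∉ us × adj G b c ≡ true × adj G a c ≡ false × c ≢ a) ⊎
  (∀ {c} → c ∉ us → adj G b c ≡ true → c ≢ a → adj G a c ≡ true)
detour? us G a b
  with Fin.any? (λ c → ¬? (c ∈? us) ×-dec adj G b c Bool.≟ true ×-dec adj G a c Bool.≟ false ×-dec ¬? (c ≟ a))
... | yes found = inj₁ found
... | no none   = inj₂ λ {c} c∉ Gbc c≢a → decidable-stable (adj G a c Bool.≟ true)
                          λ ¬Gac → none (c , c∉ , Gbc , ¬true⇒false ¬Gac , c≢a)

record Meeting (us : List (Fin n)) (q : ℕ → Fin n) (G H : Cubic n) : Set where
  constructor meeting
  field
    {G′ H′} : Cubic n
    G⇝G′    : G ⇝ G′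
    H⇝H′    : H ⇝ H′
    K₄-G′   : K₄ G′ q
    K₄-H′   : K₄ H′ q
    agree   : Agree us G′ H′

disagreement-sym : (G H : Cubic n) (v : Fin n) → disagreement G H v ≡ disagreement H G v
disagreement-sym G H v = count-cong λ u → xor-comm (adj G v u) (adj H v u)

difference∉ : ∀ {us} {G H : Cubic n} → Agree us G H → ∀ {v a} → adj G v a ≡ true → adj H v a ≡ false → a ∉ us
difference∉ {G = G} {H} agree {v} Gva Hva a∈ =
  false⇒¬true Hva (trans (≡-sym (agree-column {G = G} {H} agree v a∈)) Gva)

-- Induction on a bound for the disagreement in row v. A neighbour a of v only in `G` and a
-- neighbour b only in `H` call for a vertex c adjacent to b but not to a in `G`, or the mirror
-- image in `H`; whichever graph has one is switched.
meet-row : ∀ {us} {q : ℕ → Fin n} m (G H : Cubic n) {v} → (∀ {i} → i < 4 → q i ∈ us) → K₄ G q → K₄ H q →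
           Agree us G H → v ∉ us → disagreement G H v < m → Meeting (v ∷ us) q G H
meet-row {us = us} {q} (suc m) G H {v} q∈ KG KH agree v∉ (s≤s bound) with difference? G H v
... | inj₂ same-row = meeting ⇝-refl ⇝-refl KG KH λ { (here refl) → same-row ; (there u∈) → agree u∈ }
... | inj₁ (a , Gva , Hva) with difference? H G v
-- Rows of equal degree cannot differ on one side only.
...   | inj₂ same-row = contradiction (trans (same-row a) Gva) (false⇒¬true Hva)
...   | inj₁ (b , Hvb , Gvb) = by-detour (detour? us G a b) (detour? us H b a)
  where
  a∉ : a ∉ us
  a∉ = difference∉ {G = G} {H} agree Gva Hva
  b∉ : b ∉ us
  b∉ = difference∉ {G = H} {G} (Agree-sym {G = G} {H} agree) Hvb Gvb
  by-detour : _ → _ → Meeting (v ∷ us) q G H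
  by-detour (inj₁ (c , c∉ , Gbc , Gac , c≢a)) _ =
    let open Progress (progress G H q∈ KG agree v∉ a∉ b∉ c∉ Gva Hva Hvb Gvb Gbc Gac c≢a) renaming (agree to agree₁)
        meeting G′⇝ H⇝ KG″ KH″ agree″ = meet-row m G′ H q∈ K₄-G′ KH agree₁ v∉ (<-≤-trans closer bound)
    in meeting (⇝-trans G⇝G′ G′⇝) H⇝ KG″ KH″ agree″
  by-detour _ (inj₁ (c , c∉ , Hac , Hbc , c≢b)) =
    let open Progress (progress H G q∈ KH (Agree-sym {G = G} {H} agree) v∉ b∉ a∉ c∉ Hvb Gvb Gva Hva Hac Hbc c≢b)
          renaming (G′ to H′; G⇝G′ to H⇝H′; K₄-G′ to K₄-H′; agree to agree₁)
        meeting G⇝ H′⇝ KG″ KH″ agree″ = meet-row m G H′ q∈ KG K₄-H′ (Agree-sym {G = H′} {G} agree₁) v∉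
          (<-≤-trans (subst₂ _<_ (disagreement-sym H′ G v) (disagreement-sym H G v) closer) bound)
    in meeting G⇝ (⇝-trans H⇝H′ H′⇝) KG″ KH″ agree″
  -- Outside us the degrees of a, and those of b, are equal in G and H, whereas a has more neighbours than b in G
  -- and fewer in H.
  by-detour (inj₂ G-sub) (inj₂ H-sub) = contradiction
    (<-trans (surplus G v∉ b∉ (~⇒≢ H Hvb) Gva Gvb G-sub)
      (subst (_< count (new-neighbour us H b)) (≡-sym (new-neighbour-count {G = G} {H} agree a))
        (surplus H v∉ a∉ (~⇒≢ G Gva) Hvb Hva H-sub)))
    (<-irrefl (new-neighbour-count {G = G} {H} agree b))

meet-rows : ∀ {us} {q : ℕ → Fin n} vs (G H : Cubic n) → (∀ {i} → i < 4 → q i ∈ us) → K₄ G q → K₄ H q →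
            Agree us G H → Meeting (vs ++ us) q G H
meet-rows [] G H q∈ KG KH agree = meeting ⇝-refl ⇝-refl KG KH agree
meet-rows {us = us} (v ∷ vs) G H q∈ KG KH agree with meet-rows vs G H q∈ KG KH agree
... | meeting {G₁} {H₁} G⇝G₁ H⇝H₁ KG₁ KH₁ agree₁ with v ∈? (vs ++ us)
...   | yes v∈ = meeting G⇝G₁ H⇝H₁ KG₁ KH₁ λ { (here refl) → agree₁ v∈ ; (there u∈) → agree₁ u∈ }
...   | no v∉ =
  let meeting G₁⇝ H₁⇝ KG₂ KH₂ agree₂ = meet-row _ G₁ H₁ (∈-++⁺ʳ vs ∘ q∈) KG₁ KH₁ agree₁ v∉ ≤-refl
  in meeting (⇝-trans G⇝G₁ G₁⇝) (⇝-trans H⇝H₁ H₁⇝) KG₂ KH₂ agree₂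

-- From a common K₄ to connectedness, and the case of four vertices

K₄-closed : {G : Cubic n} {q : ℕ → Fin n} → K₄ G q → ∀ {w} → Outside q 4 w → ∀ {i} → i < 4 → adj G (q i) w ≡ false
K₄-closed {G = G} {q} K {w} w∉ {i} i<4 =
  subst (λ u → adj G u w ≡ false) (↦-≢ q (<⇒≢ i<4))
    (known-sound (extend-realises K unknown w∉ λ _ ()) (below-4 i<4 1) ≤-refl
      (All.lookup (toWitness {a? = All.all? (λ i → known (pendant 0) 5 i 4 ≟ᵐ just false) (upTo 4)} tt) (∈-upTo⁺ i<4)))

-- A K₄ is a whole component, so its rows are the same in every cubic graph containing it. This is
-- the start of `meet-rows`.
K₄-agree : {G H : Cubic n} {q : ℕ → Fin n} → K₄ G q → K₄ H q → Agree (map q (upTo 4)) G H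
K₄-agree {G = G} {H} {q} KG KH u∈ w with ∈-map⁻ q u∈ | outside? q 4 w
... | i , i∈ , refl | inj₂ w∉ = trans (K₄-closed KG w∉ (∈-upTo⁻ i∈)) (≡-sym (K₄-closed KH w∉ (∈-upTo⁻ i∈)))
... | i , i∈ , refl | inj₁ (j , j<4 , refl) with complete i j in e
...   | just b  = trans (sound KG (∈-upTo⁻ i∈) j<4 e) (≡-sym (sound KH (∈-upTo⁻ i∈) j<4 e))
...   | nothing with i ≡ᵇ j in ij
...     | true with ≡ᵇ-true⁻ {i} ij
...       | refl = trans (irrefl G (q i)) (≡-sym (irrefl H (q i)))

connected-≥8 : 8 ≤ n → Connected* n
connected-≥8 {n} 8≤n G H =
  let v = Fin.fromℕ< (≤-trans (s≤s z≤n) 8≤n)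
      G₁ , G⇝G₁ , q , KG₁ = attains-K₄ 8≤n G v
      H₁ , H⇝H₁ , t , KH₁ = attains-K₄ 8≤n H v
      G₂ , G₁⇝G₂ , q′ , KG₂ , q′≗t = relocate KG₁ (injective KH₁) 4 ≤-refl
      KG = realises-cong KG₂ q′≗t
      meeting G₂⇝ H₁⇝ _ _ agree = meet-rows (allFin n) G₂ H₁ (∈-map⁺ t ∘ ∈-upTo⁺) KG KH₁ (K₄-agree KG KH₁)
      -- Agreement on all rows makes the two meeting points one graph; the journey of `H` is then
      -- run backwards.
      reach path arrives = ⇝-trans G⇝G₁ (⇝-trans G₁⇝G₂ (⇝-trans G₂⇝
        (⇝-trans (⇝-reflexive λ u → agree (∈-++⁺ˡ (∈-allFin u))) (⇝-sym (⇝-trans H⇝H₁ H₁⇝)))))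
  in _ , path , arrives

-- If u and v were nonadjacent, then u, v and the three neighbours of u would be five vertices.
cubic₄-complete : (G : Cubic 4) {u v : Fin 4} → u ≢ v → adj G u v ≡ true
cubic₄-complete G {u} {v} u≢v = decidable-stable (adj G u v Bool.≟ true) λ u≁v →
  <-irrefl refl (subst (λ l → suc (suc l) ≤ 4) (count-adj G u)
    (unique-⊆⇒length-≤ {ys = allFin 4}
      ((u≢v ∷ All.tabulate (~⇒≢ G ∘ members⁻ {p = adj G u}))
       ∷ All.tabulate (λ { w∈ refl → u≁v (members⁻ {p = adj G u} w∈) })
       ∷ members-unique (adj G u))
      (λ {w} _ → ∈-allFin w)))

connected-4 : Connected* 4
connected-4 G H = G , ε , λ u v → by-cases u v (u ≟ v)
  where
  by-cases : ∀ u v → Dec (u ≡ v) → adj G u v ≡ adj H u v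
  by-cases u v (yes refl) = trans (irrefl G u) (≡-sym (irrefl H u))
  by-cases u v (no u≢v)   = trans (cubic₄-complete G u≢v) (≡-sym (cubic₄-complete H u≢v))

theorem9 : (n : ℕ) → n % 4 ≡ 0 → Connected* n
theorem9 0 _ G H = G , ε , λ ()
theorem9 4 _ = connected-4
theorem9 (suc (suc (suc (suc (suc (suc (suc (suc n)))))))) _ = connected-≥8 (m≤m+n 8 n)
theorem9 1 ()
theorem9 2 ()
theorem9 3 ()
theorem9 5 ()
theorem9 6 ()
theorem9 7 ()
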